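{- Let $S$ be either (i) a commutative semigroup whose universal semilattice is well-founded, or (ii) a solvable inverse semigroup whose semilattice of idempotents $E(S)$ is well-founded. Then every strongly productive ultrafilter on $S$ is idempotent.
   Context: Let $S$ be a multiplicatively written semigroup. For a sequence $\vec{x}=(x_n)_{n\in\omega}$ in $S$, $\mathrm{FP}(\vec{x})$ is the set of all products $\prod_{i\in a}x_i$ (factors taken in increasing order of indices) with $a$ ranging over the finite nonempty subsets of $\omega$; an FP-set is a set of this form. An ultrafilter $p$ on $S$ is strongly productive if for every $A\in p$ there is a sequence $\vec{x}$ with $\mathrm{FP}(\vec{x})\subseteq A$ and $\mathrm{FP}(\vec{x})\in p$. For $x\in S$ and $A\subseteq S$ put $x^{ -1}A=\{y\in S: xy\in A\}$; an ultrafilter $p$ is idempotent if $p\cdot p=p$ in $\beta S$, i.e. for every $A\in p$ the set $\{x\in S: x^{ -1}A\in p\}$ belongs to $p$. The universal semilattice of $S$ is the quotient $S/\mathcal{N}$ of $S$ by its smallest semilattice congruence $\mathcal{N}$ (a congruence whose quotient is commutative and idempotent). A semilattice $\Lambda$ is ordered by $x\le y$ iff $xy=x$; it is well-founded if every nonempty subset has a minimal element. An inverse semigroup is solvable in the sense of Piochi; in particular the solvable inverse semigroups of class $1$ are exactly the commutative inverse semigroups, and a solvable inverse semigroup of class $n+1$ has a congruence $\gamma$ with $S/\gamma$ commutative such that, for the quotient map $f:S\to S/\gamma$, the inverse subsemigroup $f^{ -1}[E(S/\gamma)]$ is solvable of class $n$. Solvable groups are exactly the solvable inverse semigroups with one idempotent.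 -}

module Defs where

open import Level using (Level; suc)
open import Algebra.Bundles using (Semigroup; CommutativeSemigroup)
open import Algebra.Definitions using (Congruent₂; Commutative; _IdempotentOn_)
open import Algebra.Structures using (IsSemigroup; IsCommutativeBand)
open import Algebra.Properties.CommutativeSemigroup using (interchange)
open import Data.List.NonEmpty using (List⁺; toList; foldr₁; map)
open import Data.List.Relation.Unary.Linked using (Linked)
open import Data.Empty.Polymorphic using (⊥)
open import Data.Nat.Base using (ℕ; _<_) renaming (suc to 1+)
open import Data.Product using (Σ; ∃; ∃-syntax; ∃!; _×_; _,_; proj₁)
open import Data.Sum.Base using (_⊎_)
open import Data.Unit.Polymorphic.Base using (⊤)
open import Function.Base using (_on_)
open import Relation.Binary.Bundles using (Setoid)
open import Relation.Binary.Core using (Rel; _⇒_)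
open import Relation.Binary.Definitions using (_Respects_)
open import Relation.Binary.Structures using (IsEquivalence)
import Relation.Binary.Construct.On as On
open import Relation.Nullary.Negation using (¬_)
import Relation.Unary as U
open U using (Pred; _≐_)

private variable
  ℓ : Level

------------------------------------------------------------------------
-- Semigroups carry a setoid equality, so a subset is a predicate that is
-- compatible with it, and a quotient keeps the carrier and coarsens _≈_.

record Subset (X : Setoid ℓ ℓ) : Set (suc ℓ) where
  open Setoid X
  field
    member   : Pred Carrier ℓ
    respects : member Respects _≈_

open Subset public

module _ {X : Setoid ℓ ℓ} where
  open Setoid X

  infix 4 _⊆_

  _⊆_ : Subset X → Subset X → Set ℓ
  A ⊆ B = member A U.⊆ member B

  whole empty : Subset X
  whole = record { member = λ _ → ⊤ ; respects = λ _ t → t }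
  empty = record { member = λ _ → ⊥ ; respects = λ _ t → t }

  infixr 7 _∩_

  _∩_ : Subset X → Subset X → Subset X
  A ∩ B = record
    { member   = member A U.∩ member B
    ; respects = λ x≈y (a , b) → respects A x≈y a , respects B x≈y b
    }

  ∁ : Subset X → Subset X
  ∁ A = record
    { member   = U.∁ (member A)
    ; respects = λ x≈y x∉A y∈A → x∉A (respects A (sym x≈y) y∈A)
    }

record Ultrafilter (X : Setoid ℓ ℓ) : Set (suc ℓ) where
  field
    large        : Pred (Subset X) ℓ
    whole-large  : large whole
    empty-small  : ¬ large empty
    ⊆-large      : ∀ {A B} → A ⊆ B → large A → large B
    ∩-large      : ∀ {A B} → large A → large B → large (A ∩ B)
    ultra        : ∀ A → large A ⊎ large (∁ A)

open Ultrafilter public using (large)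

------------------------------------------------------------------------
-- Ultrafilters on a semigroup

module _ (S : Semigroup ℓ ℓ) where
  open Semigroup S

  -- A finite nonempty subset of ω is given as a strictly increasing list.
  FP : (ℕ → Carrier) → Subset setoid
  FP x = record
    { member   = λ s → ∃[ a ] Linked _<_ (toList a) × foldr₁ _∙_ (map x a) ≈ s
    ; respects = λ s≈t (a , a↑ , e) → a , a↑ , trans e s≈t
    }

  StronglyProductive : Ultrafilter setoid → Set (suc ℓ)
  StronglyProductive p =
    ∀ A → large p A → ∃[ x ] FP x ⊆ A × large p (FP x)

  infix 8 _⁻¹·_

  _⁻¹·_ : Carrier → Subset setoid → Subset setoid
  x ⁻¹· A = record
    { member   = λ y → member A (x ∙ y)
    ; respects = λ y≈z → respects A (∙-congˡ y≈z)
    }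

  largeTranslates : Ultrafilter setoid → Subset setoid → Subset setoid
  largeTranslates q A = record
    { member   = λ x → large q (x ⁻¹· A)
    ; respects = λ {x} {y} x≈y → Ultrafilter.⊆-large q {x ⁻¹· A} {y ⁻¹· A}
                                   (respects A (∙-congʳ x≈y))
    }

  -- productLarge p q A says that A belongs to p · q in βS.
  productLarge : Ultrafilter setoid → Ultrafilter setoid → Pred (Subset setoid) ℓ
  productLarge p q A = large p (largeTranslates q A)

  IdempotentUltrafilter : Ultrafilter setoid → Set (suc ℓ)
  IdempotentUltrafilter p = productLarge p p ≐ large p

------------------------------------------------------------------------
-- Congruences, quotients and the universal semilattice

record Congruence (S : Semigroup ℓ ℓ) : Set (suc ℓ) where
  open Semigroup S using (Carrier; _≈_; _∙_)
  infix 4 _~_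
  field
    _~_           : Rel Carrier ℓ
    ≈⇒~           : _≈_ ⇒ _~_
    isEquivalence : IsEquivalence _~_
    ∙-cong        : Congruent₂ _~_ _∙_

infixl 7 _/_

_/_ : (S : Semigroup ℓ ℓ) → Congruence S → Semigroup ℓ ℓ
S / γ = record
  { Carrier     = Carrier
  ; _≈_         = _~_
  ; _∙_         = _∙_
  ; isSemigroup = record
    { isMagma = record { isEquivalence = isEquivalence ; ∙-cong = ∙-cong }
    ; assoc   = λ x y z → ≈⇒~ (assoc x y z)
    }
  }
  where
  open Semigroup S using (Carrier; _∙_; assoc)
  open Congruence γ

IsCommutative : Semigroup ℓ ℓ → Set ℓ
IsCommutative S = Commutative _≈_ _∙_
  where open Semigroup S

IsSemilattice : Semigroup ℓ ℓ → Set ℓ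
IsSemilattice S = IsCommutativeBand _≈_ _∙_
  where open Semigroup S

module _ (S : Semigroup ℓ ℓ) where
  open Semigroup S

  -- The congruence generated by commutativity and idempotency;
  -- 𝓝-semilattice and 𝓝-smallest show that it is the smallest
  -- semilattice congruence.
  data 𝓝-Rel : Rel Carrier ℓ where
    𝓝-≈     : ∀ {x y} → x ≈ y → 𝓝-Rel x y
    𝓝-comm  : ∀ x y → 𝓝-Rel (x ∙ y) (y ∙ x)
    𝓝-idem  : ∀ x → 𝓝-Rel (x ∙ x) x
    𝓝-sym   : ∀ {x y} → 𝓝-Rel x y → 𝓝-Rel y x
    𝓝-trans : ∀ {x y z} → 𝓝-Rel x y → 𝓝-Rel y z → 𝓝-Rel x z
    𝓝-cong  : ∀ {x y u v} → 𝓝-Rel x y → 𝓝-Rel u v → 𝓝-Rel (x ∙ u) (y ∙ v)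

  𝓝 : Congruence S
  𝓝 = record
    { _~_           = 𝓝-Rel
    ; ≈⇒~           = 𝓝-≈
    ; isEquivalence = record { refl = 𝓝-≈ refl ; sym = 𝓝-sym ; trans = 𝓝-trans }
    ; ∙-cong        = 𝓝-cong
    }

  universalSemilattice : Semigroup ℓ ℓ
  universalSemilattice = S / 𝓝

  𝓝-semilattice : IsSemilattice universalSemilattice
  𝓝-semilattice = record
    { isBand = record
      { isSemigroup = Semigroup.isSemigroup universalSemilattice
      ; idem        = 𝓝-idem
      }
    ; comm = 𝓝-comm
    }

  𝓝-smallest : (γ : Congruence S) → IsSemilattice (S / γ) →
               𝓝-Rel ⇒ Congruence._~_ γ
  𝓝-smallest γ sl = go
    where
    open Congruence γ using (_~_; ≈⇒~)
    module L = IsCommutativeBand sl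

    go : 𝓝-Rel ⇒ _~_
    go (𝓝-≈ e)       = ≈⇒~ e
    go (𝓝-comm x y)  = L.comm x y
    go (𝓝-idem x)    = L.idem x
    go (𝓝-sym r)     = L.sym (go r)
    go (𝓝-trans r s) = L.trans (go r) (go s)
    go (𝓝-cong r s)  = L.∙-cong (go r) (go s)

------------------------------------------------------------------------
-- Well-founded semilattices

module _ (S : Semigroup ℓ ℓ) where
  open Semigroup S

  infix 4 _≤_

  _≤_ : Rel Carrier ℓ
  x ≤ y = x ∙ y ≈ x

  -- E(S)
  Idempotents : Pred Carrier ℓ
  Idempotents e = _IdempotentOn_ _≈_ _∙_ e

  -- The semilattice is a subset L of S, so that this applies both to S
  -- itself and to E(S) inside an inverse semigroup S.
  WellFoundedSemilattice : ∀ {e} → Pred Carrier e → Set _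
  WellFoundedSemilattice L =
    (A : Subset setoid) → member A U.⊆ L → ∃ (member A) →
    ∃[ m ] member A m × (∀ y → member A y → y ≤ m → y ≈ m)

------------------------------------------------------------------------
-- Solvable inverse semigroups

IsInverseSemigroup : Semigroup ℓ ℓ → Set ℓ
IsInverseSemigroup S =
  ∀ x → ∃! _≈_ (λ y → (x ∙ y) ∙ x ≈ x × (y ∙ x) ∙ y ≈ y)
  where open Semigroup S

-- The subsemigroup f⁻¹[E(S/γ)] for the quotient map f : S → S/γ, which is
-- the identity on carriers.
kernel : (S : Semigroup ℓ ℓ) (γ : Congruence S) → IsCommutative (S / γ) →
         Semigroup ℓ ℓ
kernel S γ comm = record
  { Carrier     = Σ Carrier (Idempotents (S / γ))
  ; _≈_         = _≈_ on proj₁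
  ; _∙_         = λ (s , s²~s) (t , t²~t) →
                    s ∙ t , Q.trans (interchange CQ s t s t) (Q.∙-cong s²~s t²~t)
  ; isSemigroup = record
    { isMagma = record
      { isEquivalence = On.isEquivalence proj₁ isEquivalence
      ; ∙-cong        = ∙-cong
      }
    ; assoc = λ (s , _) (t , _) (u , _) → assoc s t u
    }
  }
  where
  open Semigroup S
  module Q = Semigroup (S / γ)

  CQ : CommutativeSemigroup _ _
  CQ = record
    { isCommutativeSemigroup = record { isSemigroup = Q.isSemigroup ; comm = comm } }

-- The classes start at 1: nothing is solvable of class 0.
data SolvableOfClass {ℓ} : ℕ → Semigroup ℓ ℓ → Set (suc ℓ) where
  commutative : ∀ {S} → IsInverseSemigroup S → IsCommutative S →
                SolvableOfClass 1 S
  extension   : ∀ {S n} → IsInverseSemigroup S →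
                (γ : Congruence S) (comm : IsCommutative (S / γ)) →
                SolvableOfClass n (kernel S γ comm) →
                SolvableOfClass (1+ n) S

SolvableInverse : Semigroup ℓ ℓ → Set (suc ℓ)
SolvableInverse S = ∃[ n ] SolvableOfClass n S

{-# OPTIONS --safe #-}

-- Call a strongly productive ultrafilter p regular if some B ∈ p satisfies
-- x₀ · FP(x₁, x₂, …) ∉ p whenever FP(x) ⊆ B.  Unless p is principal, all tails of
-- an FP-set FP(x) ⊆ A ∩ B in p are then in p, and s⁻¹ A contains a tail for every
-- s ∈ FP(x); so p is idempotent.  Regularity lifts along homomorphisms, which reduces
-- the question to abelian groups.
--
-- Abelian groups: FP(x) ∈ p generates a countable subgroup, which has enough
-- characters χⱼ into ℚ/ℤ.  If some χⱼ does not vanish p-almost everywhere, take for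
-- B the z with χⱼ(z) in one half of the circle: n-fold products inside
-- x₀ · FP(x₁, …) have values at least n χⱼ(x₀).  If all χⱼ vanish almost everywhere,
-- take the z for which χⱼ(z), with j the first index such that χⱼ(z²) ≠ 0, is in
-- one half: almost all elements of x₀ · FP(x₁, …) are killed by the first few
-- characters, so their second factor has the value opposite to that of x₀.
--
-- Commutative semigroups: by well-foundedness p is regular or contains an
-- archimedean component.  There one passes to the group of fractions, or p contains
-- the elements that become trivial in it; these are nilpotent modulo the idempotent
-- of the component, and all elements of x₀ · FP(x₁, …) have a factor x₀.
--
-- Solvable inverse semigroups: the image in S/γ is regular or principal, and in the
-- latter case p lives on the kernel, which has smaller class.

module Submission where

open import Defs
open import Level using (Level) renaming (suc to lsuc)
open import Algebra.Bundles using (AbelianGroup; CommutativeSemigroup; Semigroup)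
import Algebra.Construct.DirectProduct as DirectProduct
open import Algebra.Morphism.Structures using (module MagmaMorphisms)
import Algebra.Properties.AbelianGroup as AbelianGroupProperties
import Algebra.Properties.CommutativeMonoid.Mult as Mult
import Algebra.Properties.CommutativeSemigroup as CommutativeSemigroupProperties
open import Axiom.ExcludedMiddle using (ExcludedMiddle)
open import Data.Empty using (⊥-elim)
open import Data.Integer.Base as ℤ using (ℤ; +_; -[1+_])
import Data.Integer.DivMod as ℤ
import Data.Integer.Properties as ℤ
open import Data.List.Base using ([]; _∷_)
open import Data.List.NonEmpty using (List⁺; _∷_; _∷⁺_; toList; foldr₁; map; head)
open import Data.List.Relation.Unary.Linked using (Linked; [-]; _∷_)
open import Data.Nat.Base as ℕ using (ℕ; zero; suc; _+_; _∸_; _<_)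
open import Data.Nat.Binary.Base as ℕᵇ using (ℕᵇ; zero; 2[1+_]; 1+[2_])
import Data.Nat.Binary.Properties as ℕᵇ
import Data.Nat.Coprimality as Coprime
import Data.Nat.DivMod as ℕ
open import Data.Nat.Induction using (<-rec)
import Data.Nat.Properties as ℕ
open import Data.Product using (Σ; ∃; ∃-syntax; _×_; _,_; proj₁; proj₂)
open import Data.Rational.Base as ℚ using (ℚ; mkℚ; 0ℚ; 1ℚ; ½)
import Data.Rational.Properties as ℚ
open import Data.Rational.Solver using (module +-*-Solver)
import Data.Rational.Unnormalised.Base as ℚᵘ
import Data.Rational.Unnormalised.Properties as ℚᵘ
open import Data.Sum.Base as Sum using (_⊎_; inj₁; inj₂; [_,_]′)
open import Data.Unit.Polymorphic.Base using (tt)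
open import Function.Base using (_∘_; _on_; id)
open import Relation.Binary.Bundles using (Setoid)
import Relation.Binary.Construct.On as On
open import Relation.Binary.Definitions using (_Respects_; tri<; tri≈; tri>)
open import Relation.Binary.PropositionalEquality as ≡ using (_≡_)
import Relation.Binary.Reasoning.Setoid as ≈-Reasoning
open import Relation.Nullary using (Dec; yes; no; ¬_)
open import Relation.Nullary.Decidable using (toWitness)
open import Relation.Unary using (Pred; U)

private variable
  ℓ : Level

-- Products along a sequence, strongly productive and regular ultrafilters

module _ (S : Semigroup ℓ ℓ) where
  open Semigroup S

  -- A code is the characteristic word of a finite nonempty set of indices, up
  -- to its maximum: 2[1+_] takes the current index, 1+[2_] skips it.
  product : (ℕ → Carrier) → ℕᵇ → Carrier
  product x zero     = x 0
  product x 2[1+ b ] = x 0 ∙ product (x ∘ suc) b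
  product x 1+[2 b ] = product (x ∘ suc) b

  Products : (ℕ → Carrier) → Subset setoid
  Products x = record
    { member   = λ s → ∃[ b ] product x b ≈ s
    ; respects = λ s≈t (b , e) → b , trans e s≈t
    }

  translate : Carrier → Subset setoid → Subset setoid
  translate s A = record
    { member   = λ u → ∃[ t ] member A t × s ∙ t ≈ u
    ; respects = λ u≈v (t , t∈A , e) → t , t∈A , trans e u≈v
    }

  singleton : Carrier → Subset setoid
  singleton s = record { member = s ≈_ ; respects = λ u≈v e → trans e u≈v }

  Productive : Ultrafilter setoid → Set (lsuc ℓ)
  Productive p = ∀ {A} → large p A →
    ∃[ x ] (∀ b → member A (product x b)) × large p (Products x)

  -- The form is chosen so that it can be applied to `drop S n x` for every n: tails of a sequence
  -- inside `B` stay inside `B`.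
  Regular : Ultrafilter setoid → Set (lsuc ℓ)
  Regular p = ∃[ B ] large p B ×
    (∀ x → (∀ b → member B (product x b)) →
     ¬ large p (translate (x 0) (Products (x ∘ suc))))

  Principal : Ultrafilter setoid → Set ℓ
  Principal p = ∃[ s ] large p (singleton s)

  -- The recursion makes `drop (suc n) x` by definition the tail of `drop n x`, as the induction
  -- over tails requires.
  drop : ℕ → (ℕ → Carrier) → ℕ → Carrier
  drop zero    x = x
  drop (suc n) x = drop n x ∘ suc

  drop-+ : ∀ n x m → drop n x m ≡ x (n + m)
  drop-+ zero    x m = ≡.refl
  drop-+ (suc n) x m = ≡.trans (drop-+ n x (suc m)) (≡.cong x (ℕ.+-suc n m))

  drop-head : ∀ n x → drop n x 0 ≡ x n
  drop-head n x = ≡.trans (drop-+ n x 0) (≡.cong x (ℕ.+-identityʳ n))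

  -- `g` counts the indices still to be skipped between the current position `k` and the next chosen
  -- index `i`.
  encode : ∀ x g k i is → g + k ≡ i → Linked _<_ (i ∷ is) →
           ∃[ b ] product (drop k x) b ≈ foldr₁ _∙_ (map x (i ∷ is))
  encode x (suc g) k i is e l =
    let b , q = encode x g (suc k) i is (≡.trans (ℕ.+-suc g k) e) l
    in 1+[2 b ] , q
  encode x zero k .k [] ≡.refl l = zero , reflexive (drop-head k x)
  encode x zero k .k (j ∷ js) ≡.refl (k<j ∷ l) =
    let b , q = encode x (j ∸ suc k) (suc k) j js (ℕ.m∸n+n≡m k<j) l
    in 2[1+ b ] , ∙-cong (reflexive (drop-head k x)) q

  positions : ℕ → ℕᵇ → List⁺ ℕ
  positions k zero     = k ∷ []
  positions k 2[1+ b ] = k ∷⁺ positions (suc k) b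
  positions k 1+[2 b ] = positions (suc k) b

  positions-≥ : ∀ k b → k ℕ.≤ head (positions k b)
  positions-≥ k zero     = ℕ.≤-refl
  positions-≥ k 2[1+ b ] = ℕ.≤-refl
  positions-≥ k 1+[2 b ] = ℕ.≤-trans (ℕ.n≤1+n k) (positions-≥ (suc k) b)

  positions-↑ : ∀ k b → Linked _<_ (toList (positions k b))
  positions-↑ k zero     = [-]
  positions-↑ k 2[1+ b ] = positions-≥ (suc k) b ∷ positions-↑ (suc k) b
  positions-↑ k 1+[2 b ] = positions-↑ (suc k) b

  foldr₁-positions : ∀ x k b →
    foldr₁ _∙_ (map x (positions k b)) ≈ product (drop k x) b
  foldr₁-positions x k zero     = sym (reflexive (drop-head k x))
  foldr₁-positions x k 2[1+ b ] =
    ∙-cong (sym (reflexive (drop-head k x))) (foldr₁-positions x (suc k) b)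
  foldr₁-positions x k 1+[2 b ] = foldr₁-positions x (suc k) b

  FP⊆Products : ∀ x → FP S x ⊆ Products x
  FP⊆Products x (i ∷ is , l , e) =
    let b , q = encode x i 0 i is (ℕ.+-identityʳ i) l in b , trans q e

  product∈FP : ∀ x b → member (FP S x) (product x b)
  product∈FP x b = positions 0 b , positions-↑ 0 b , foldr₁-positions x 0 b

  stronglyProductive⇒productive : ∀ p → StronglyProductive S p → Productive p
  stronglyProductive⇒productive p sp {A} A∈p =
    let x , FP⊆A , FP∈p = sp A A∈p
    in x , (λ b → FP⊆A (product∈FP x b))
         , Ultrafilter.⊆-large p {FP S x} {Products x} (FP⊆Products x) FP∈p

  product-cong : ∀ {x y} → (∀ n → x n ≈ y n) → ∀ b → product x b ≈ product y b
  product-cong e zero     = e 0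
  product-cong e 2[1+ b ] = ∙-cong (e 0) (product-cong (e ∘ suc) b)
  product-cong e 1+[2 b ] = product-cong (e ∘ suc) b

  factor∈Products : ∀ x n → ∃[ b ] product x b ≈ x n
  factor∈Products x zero    = zero , refl
  factor∈Products x (suc n) =
    let b , e = factor∈Products (x ∘ suc) n in 1+[2 b ] , e

  size : ℕᵇ → ℕ
  size zero     = 1
  size 2[1+ b ] = suc (size b)
  size 1+[2 b ] = suc (size b)

  -- The final letter `zero` also takes its index, so it becomes `2[1+_]` once another word follows.
  append : ℕᵇ → ℕᵇ → ℕᵇ
  append zero     c = 2[1+ c ]
  append 2[1+ b ] c = 2[1+ append b c ]
  append 1+[2 b ] c = 1+[2 append b c ]

  drop-suc : ∀ n x m → drop n (x ∘ suc) m ≡ drop (suc n) x m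
  drop-suc n x m = ≡.trans (drop-+ n (x ∘ suc) m) (≡.sym (drop-+ (suc n) x m))

  -- The second factor uses only indices beyond the maximum of `b`, so the two products concatenate
  -- by associativity.
  product-append : ∀ x b c →
    product x b ∙ product (drop (size b) x) c ≈ product x (append b c)
  product-append x zero     c = refl
  product-append x 2[1+ b ] c = trans (assoc _ _ _) (∙-congˡ (trans
    (∙-congˡ (product-cong (λ m → reflexive (≡.sym (drop-suc (size b) x m))) c))
    (product-append (x ∘ suc) b c)))
  product-append x 1+[2 b ] c = trans
    (∙-congˡ (product-cong (λ m → reflexive (≡.sym (drop-suc (size b) x m))) c))
    (product-append (x ∘ suc) b c)

module _ {X : Setoid ℓ ℓ} (p : Ultrafilter X) where
  open Ultrafilter p hiding (large)

  -- Primality of ultrafilters: if `B` is not large, then A ∩ ∁ B is large and lies in `C`.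
  large-split : ∀ {A} B C → large p A →
    (∀ {x} → member A x → member B x ⊎ member C x) → large p B ⊎ large p C
  large-split {A} B C A∈p cover with ultra B
  ... | inj₁ B∈p  = inj₁ B∈p
  ... | inj₂ ∁B∈p = inj₂ (⊆-large {A ∩ ∁ B} {C}
    (λ (a , x∉B) → [ (λ b → ⊥-elim (x∉B b)) , id ]′ (cover a))
    (∩-large A∈p ∁B∈p))

  large-∁ : ∀ A → ¬ large p A → large p (∁ A)
  large-∁ A A∉p with ultra A
  ... | inj₁ A∈p  = ⊥-elim (A∉p A∈p)
  ... | inj₂ ∁A∈p = ∁A∈p

  large-disjoint : ∀ {A B} → large p A → large p B →
    (∀ {x} → member A x → ¬ member B x) → ∀ {w} {W : Set w} → W
  large-disjoint {A} {B} A∈p B∈p dis = ⊥-elim (empty-small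
    (⊆-large {A ∩ B} {empty} (λ (a , b) → ⊥-elim (dis a b)) (∩-large A∈p B∈p)))

-- Idempotency of principal and of regular productive ultrafilters

module _ {S : Semigroup ℓ ℓ} (p : Ultrafilter (Semigroup.setoid S))
         (pr : Productive S p) where
  open Semigroup S
  open Ultrafilter p hiding (large)

  productive⇒inhabited : ∀ {A} → large p A → ∃ (member A)
  productive⇒inhabited A∈p = let x , x⊆A , _ = pr A∈p in x 0 , x⊆A zero

  -- The constant subsets turn the ultrafilter into a decision procedure: a
  -- large one contains a product, hence is inhabited.
  productive⇒em : ExcludedMiddle ℓ
  productive⇒em {P} with ultra (record { member = λ _ → P ; respects = λ _ t → t })
  ... | inj₁ P∈p  = yes (proj₂ (productive⇒inhabited P∈p))
  ... | inj₂ ¬P∈p = no  (proj₂ (productive⇒inhabited ¬P∈p))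

  -- For a sequence with all products equal to `s`, compare x₀, x₁ and x₀ ∙ x₁.
  principal⇒idempotent : ∀ {s} → large p (singleton S s) → s ∙ s ≈ s
  principal⇒idempotent s∈p =
    let x , e , _ = pr s∈p
    in trans (∙-cong (e zero) (e 1+[2 zero ])) (sym (e 2[1+ zero ]))

  -- A product is x₀, or x₀ times a product of the tail, or a product of the tail; the first two
  -- kinds form small sets.
  tail-large : ∀ {x} → ¬ Principal S p →
    ¬ large p (translate S (x 0) (Products S (x ∘ suc))) →
    large p (Products S x) → large p (Products S (x ∘ suc))
  tail-large {x} np no-translate x∈p
    with large-split p (singleton S (x 0) ∪ translate S (x 0) (Products S (x ∘ suc)))
                       (Products S (x ∘ suc)) x∈p cases
    where
    infixr 6 _∪_
    _∪_ : Subset setoid → Subset setoid → Subset setoid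
    A ∪ B = record
      { member   = λ s → member A s ⊎ member B s
      ; respects = λ e → [ (λ a → inj₁ (respects A e a)) , (λ b → inj₂ (respects B e b)) ]′
      }

    cases : ∀ {s} → member (Products S x) s → _
    cases (zero , e)     = inj₁ (inj₁ e)
    cases (2[1+ b ] , e) = inj₁ (inj₂ (_ , (b , refl) , e))
    cases (1+[2 b ] , e) = inj₂ (b , e)
  ... | inj₂ tail∈p = tail∈p
  ... | inj₁ rest∈p
    with large-split p (singleton S (x 0)) (translate S (x 0) (Products S (x ∘ suc))) rest∈p id
  ... | inj₁ point∈p     = ⊥-elim (np (x 0 , point∈p))
  ... | inj₂ translate∈p = ⊥-elim (no-translate translate∈p)

  -- Maximality of ultrafilters: if `A` were in p · p but not in `p`, then ∁ A would be in p · p as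
  -- well.
  ⊆⇒idempotent : (∀ A → large p A → productLarge S p p A) →
                 IdempotentUltrafilter S p
  ⊆⇒idempotent incl = to , λ {A} → incl A
    where
    to : ∀ {A} → productLarge S p p A → large p A
    to {A} A∈pp with ultra A
    ... | inj₁ A∈p  = A∈p
    ... | inj₂ ∁A∈p = large-disjoint p A∈pp (incl (∁ A) ∁A∈p)
      (λ sA∈p s∁A∈p → large-disjoint p sA∈p s∁A∈p (λ a ¬a → ¬a a))

  principal⇒idempotentUltrafilter : Principal S p → IdempotentUltrafilter S p
  principal⇒idempotentUltrafilter (s , s∈p) = ⊆⇒idempotent λ A A∈p →
    let t , s≈t , t∈A = productive⇒inhabited (∩-large {singleton S s} {A} s∈p A∈p)
        ss∈A = respects A (trans (sym s≈t) (sym (principal⇒idempotent s∈p))) t∈A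
    in ⊆-large {singleton S s} {largeTranslates S p A}
         (λ e → ⊆-large {singleton S s} {_⁻¹·_ S _ A}
           (λ e′ → respects A (∙-cong e e′) ss∈A) s∈p) s∈p

  regular⇒idempotentUltrafilter : ¬ Principal S p → Regular S p →
                                  IdempotentUltrafilter S p
  regular⇒idempotentUltrafilter np (B , B∈p , reg) = ⊆⇒idempotent incl
    where
    drop-large : ∀ x → (∀ b → member B (product S x b)) → large p (Products S x) →
      ∀ n → large p (Products S (drop S n x)) × (∀ b → member B (product S (drop S n x) b))
    drop-large x x⊆B x∈p zero    = x∈p , x⊆B
    drop-large x x⊆B x∈p (suc n) =
      let y∈p , y⊆B = drop-large x x⊆B x∈p n
      in tail-large np (reg _ y⊆B) y∈p , λ b → y⊆B 1+[2 b ]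

    incl : ∀ A → large p A → productLarge S p p A
    incl A A∈p =
      let x , x⊆AB , x∈p = pr (∩-large {A} {B} A∈p B∈p)
      in ⊆-large {Products S x} {largeTranslates S p A}
           -- For s = `product S x b`, each product over the indices beyond `b` yields a product of
           -- x again when multiplied by s; this tail is large by regularity.
           (λ {s} (b , e) → ⊆-large {Products S (drop S (size S b) x)} {_⁻¹·_ S s A}
             (λ (c , e′) → respects A
               (trans (sym (product-append S x b c)) (∙-cong e e′))
               (proj₁ (x⊆AB (append S b c))))
             (proj₁ (drop-large x (λ b → proj₂ (x⊆AB b)) x∈p (size S b))))
           x∈p

-- Push-forward and restriction

module _ (S T : Semigroup ℓ ℓ) where
  open MagmaMorphisms (Semigroup.rawMagma S) (Semigroup.rawMagma T)
  private
    module S = Semigroup S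
    module T = Semigroup T

  module _ (f : S.Carrier → T.Carrier) (f-homo : IsMagmaHomomorphism f) where
    open IsMagmaHomomorphism f-homo

    product-homo : ∀ x b → f (product S x b) T.≈ product T (f ∘ x) b
    product-homo x zero     = T.refl
    product-homo x 2[1+ b ] = T.trans (homo _ _) (T.∙-congˡ (product-homo (x ∘ ℕ.suc) b))
    product-homo x 1+[2 b ] = product-homo (x ∘ ℕ.suc) b

    preimage : Subset T.setoid → Subset S.setoid
    preimage A = record { member = member A ∘ f ; respects = respects A ∘ ⟦⟧-cong }

    image : Subset S.setoid → Subset T.setoid
    image A = record
      { member   = λ t → ∃[ s ] member A s × f s T.≈ t
      ; respects = λ t≈u (s , s∈A , e) → s , s∈A , T.trans e t≈u
      }

    pushforward : Ultrafilter S.setoid → Ultrafilter T.setoid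
    pushforward p = record
      { large       = large p ∘ preimage
      ; whole-large = P.whole-large
      ; empty-small = P.empty-small
      ; ⊆-large     = λ {A} {B} A⊆B → P.⊆-large {preimage A} {preimage B} A⊆B
      ; ∩-large     = P.∩-large
      ; ultra       = P.ultra ∘ preimage
      }
      where module P = Ultrafilter p

    pushforward-productive : ∀ p → Productive S p → Productive T (pushforward p)
    pushforward-productive p pr {A} A∈p =
      let x , x⊆A , x∈p = pr A∈p
      in f ∘ x , (λ b → respects A (product-homo x b) (x⊆A b))
       , Ultrafilter.⊆-large p {Products S x} {preimage (Products T (f ∘ x))}
           (λ (b , e) → b , T.trans (T.sym (product-homo x b)) (⟦⟧-cong e)) x∈p

    pushforward-regular : ∀ p → Regular T (pushforward p) → Regular S p
    pushforward-regular p (B , B∈p , reg) = preimage B , B∈p , λ x x⊆B tr∈p →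
      reg (f ∘ x) (λ b → respects B (product-homo x b) (x⊆B b))
        (Ultrafilter.⊆-large p
          {translate S (x 0) (Products S (x ∘ ℕ.suc))}
          {preimage (translate T (f (x 0)) (Products T (f ∘ x ∘ ℕ.suc)))}
          (λ (t , (b , e) , e′) → f t ,
            (b , T.trans (T.sym (product-homo (x ∘ ℕ.suc) b)) (⟦⟧-cong e)) ,
            T.trans (T.sym (homo _ _)) (⟦⟧-cong e′))
          tr∈p)

  module _ (f : S.Carrier → T.Carrier) (f-mono : IsMagmaMonomorphism f) where
    open IsMagmaMonomorphism f-mono

    private
      img = image f isMagmaHomomorphism

    module _ (p : Ultrafilter T.setoid) (S∈p : large p (img whole)) where
      private module P = Ultrafilter p

      restriction : Ultrafilter S.setoid
      restriction = record
        { large       = large p ∘ img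
        ; whole-large = S∈p
        ; empty-small = λ ∅∈p → P.empty-small (P.⊆-large {img empty} {empty} (λ ()) ∅∈p)
        ; ⊆-large     = λ {A} {B} A⊆B → P.⊆-large {img A} {img B}
                          λ (s , a , e) → s , A⊆B a , e
        ; ∩-large     = λ {A} {B} A∈p B∈p → P.⊆-large {img A ∩ img B} {img (A ∩ B)}
            (λ ((s , a , e) , (s′ , b , e′)) →
              s , (a , respects B (injective (T.trans e′ (T.sym e))) b) , e)
            (P.∩-large A∈p B∈p)
        ; ultra       = ultra
        }
        where
        ultra : ∀ A → large p (img A) ⊎ large p (img (∁ A))
        ultra A with P.ultra (img A)
        ... | inj₁ A∈p  = inj₁ A∈p
        ... | inj₂ ∁A∈p = inj₂ (P.⊆-large {img whole ∩ ∁ (img A)} {img (∁ A)}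
          (λ ((s , _ , e) , t∉A) → s , (λ a → t∉A (s , a , e)) , e)
          (P.∩-large S∈p ∁A∈p))

      -- The factors of x are products themselves, so each lifts to `S`; injectivity of `f` then
      -- identifies the products of the lifts with the given preimages in `A`.
      lift-products : ∀ {A} x → (∀ b → member (img A) (product T x b)) →
        ∃[ y ] (∀ n → f (y n) T.≈ x n) × (∀ b → member A (product S y b))
             × (∀ b → f (product S y b) T.≈ product T x b)
      lift-products {A} x x⊆A = y , fy≈x , y⊆A , f-y
        where
        factor : ∀ n → member (img A) (x n)
        factor n = let b , e = factor∈Products T x n in respects (img A) e (x⊆A b)
        y = λ n → proj₁ (factor n)
        fy≈x : ∀ n → f (y n) T.≈ x n
        fy≈x n = proj₂ (proj₂ (factor n))
        f-y : ∀ b → f (product S y b) T.≈ product T x b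
        f-y b = T.trans (product-homo f isMagmaHomomorphism y b) (product-cong T fy≈x b)
        y⊆A : ∀ b → member A (product S y b)
        y⊆A b = let s , a , e = x⊆A b
                in respects A (injective (T.trans e (T.sym (f-y b)))) a

      restriction-productive : Productive T p → Productive S restriction
      restriction-productive pr {A} A∈p =
        let x , x⊆A , x∈p = pr A∈p
            y , _ , y⊆A , f-y = lift-products {A} x x⊆A
        in y , y⊆A , P.⊆-large {Products T x} {img (Products S y)}
             (λ (b , e) → product S y b , (b , S.refl) , T.trans (f-y b) e) x∈p

      restriction-regular : Regular S restriction → Regular T p
      restriction-regular (B , B∈p , reg) = img B , B∈p , λ x x⊆B tr∈p →
        let y , fy≈x , y⊆B , f-y = lift-products {B} x x⊆B
        in reg y y⊆B (P.⊆-large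
             {translate T (x 0) (Products T (x ∘ ℕ.suc))}
             {img (translate S (y 0) (Products S (y ∘ ℕ.suc)))}
             (λ (t , (b , e) , e′) → _ , (_ , (b , S.refl) , S.refl) ,
               T.trans (homo _ _) (T.trans (T.∙-cong (fy≈x 0) (T.trans (f-y 1+[2 b ]) e)) e′))
             tr∈p)

      restriction-principal : Principal S restriction → Principal T p
      restriction-principal (s , s∈p) = f s , P.⊆-large
        {img (singleton S s)} {singleton T (f s)}
        (λ (s′ , e , e′) → T.trans (⟦⟧-cong e) e′) s∈p

-- Rationals modulo integers

private module ℚ+ where
  open AbelianGroup ℚ.+-0-abelianGroup public using (commutativeMonoid)
  open Mult commutativeMonoid public

fromℤ : ℤ → ℚ
fromℤ z = mkℚ z 0 (Coprime.sym (Coprime.1-coprimeTo _))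

fromℤ-+ : ∀ z w → fromℤ z ℚ.+ fromℤ w ≡ fromℤ (z ℤ.+ w)
fromℤ-+ z w = ℚ.toℚᵘ-injective (ℚᵘ.≃-trans (ℚ.toℚᵘ-homo-+ (fromℤ z) (fromℤ w))
  (ℚᵘ.*≡* (≡.cong (ℤ._* + 1) (≡.cong₂ ℤ._+_ (ℤ.*-identityʳ z) (ℤ.*-identityʳ w)))))

fromℤ-neg : ∀ z → ℚ.- fromℤ z ≡ fromℤ (ℤ.- z)
fromℤ-neg (+ zero)  = ≡.refl
fromℤ-neg (+ suc n) = ≡.refl
fromℤ-neg -[1+ n ]  = ≡.refl

IsInteger : ℚ → Set
IsInteger q = ∃[ z ] q ≡ fromℤ z

integer-0 : IsInteger 0ℚ
integer-0 = + 0 , ≡.refl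

integer-1 : IsInteger 1ℚ
integer-1 = + 1 , ≡.refl

integer-+ : ∀ {q r} → IsInteger q → IsInteger r → IsInteger (q ℚ.+ r)
integer-+ (z , ≡.refl) (w , ≡.refl) = _ , fromℤ-+ z w

integer-neg : ∀ {q} → IsInteger q → IsInteger (ℚ.- q)
integer-neg (z , ≡.refl) = _ , fromℤ-neg z

neg-involutive : ∀ q → ℚ.- (ℚ.- q) ≡ q
neg-involutive = solve 1 (λ q → :- (:- q) := q) ≡.refl
  where open +-*-Solver

integer-neg⁻¹ : ∀ {q} → IsInteger (ℚ.- q) → IsInteger q
integer-neg⁻¹ {q} i = ≡.subst IsInteger (neg-involutive q) (integer-neg i)

∉ℤ-between-0-1 : ∀ {q} → 0ℚ ℚ.< q → q ℚ.< 1ℚ → ¬ IsInteger q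
∉ℤ-between-0-1 (ℚ.*<* 0<n) (ℚ.*<* n<1) (z , ≡.refl) =
  ℤ.<-irrefl ≡.refl (ℤ.<-≤-trans n<1′ (ℤ.i<j⇒suc[i]≤j 0<n′))
  where
  0<n′ : + 0 ℤ.< z
  0<n′ = ≡.subst (+ 0 ℤ.<_) (ℤ.*-identityʳ z) 0<n
  n<1′ : z ℤ.< + 1
  n<1′ = ≡.subst (ℤ._< + 1) (ℤ.*-identityʳ z) n<1

∉ℤ-gap : ∀ {q r} → q ℚ.< r → r ℚ.< q ℚ.+ 1ℚ → ¬ IsInteger (r ℚ.- q)
∉ℤ-gap {q} {r} q<r r<q+1 = ∉ℤ-between-0-1
  (≡.subst (ℚ._< r ℚ.- q) (ℚ.+-inverseʳ q) (ℚ.+-monoˡ-< (ℚ.- q) q<r))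
  (≡.subst (r ℚ.- q ℚ.<_)
    (solve 2 (λ q i → q :+ i :+ (:- q) := i) ≡.refl q 1ℚ)
    (ℚ.+-monoˡ-< (ℚ.- q) r<q+1))
  where open +-*-Solver

InLowerHalf : ℚ → Set
InLowerHalf q = 0ℚ ℚ.< q × q ℚ.< ½

0<½ : 0ℚ ℚ.< ½
0<½ = toWitness {a? = 0ℚ ℚ.<? ½} _

½<1 : ½ ℚ.< 1ℚ
½<1 = toWitness {a? = ½ ℚ.<? 1ℚ} _

½∉ℤ : ¬ IsInteger ½
½∉ℤ = ∉ℤ-between-0-1 0<½ ½<1

lowerHalf-+ : ∀ {q r} → InLowerHalf q → InLowerHalf r →
              0ℚ ℚ.< q ℚ.+ r × q ℚ.+ r ℚ.< 1ℚ
lowerHalf-+ (0<q , q<½) (0<r , r<½) = ℚ.+-mono-< 0<q 0<r , ℚ.+-mono-< q<½ r<½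

lowerHalf-+∉ℤ : ∀ {q r} → InLowerHalf q → InLowerHalf r → ¬ IsInteger (q ℚ.+ r)
lowerHalf-+∉ℤ q∈ r∈ = let 0<s , s<1 = lowerHalf-+ q∈ r∈ in ∉ℤ-between-0-1 0<s s<1

-- Both `s` and q + r lie strictly between 0 and 1, so an integral difference can only be 0.
lowerHalf-no-carry : ∀ {q r s} → InLowerHalf q → InLowerHalf r → InLowerHalf s →
                     IsInteger (s ℚ.- (q ℚ.+ r)) → s ≡ q ℚ.+ r
lowerHalf-no-carry {q} {r} {s} q∈ r∈ (0<s , s<½) i
  with ℚ.<-cmp s (q ℚ.+ r) | lowerHalf-+ q∈ r∈
... | tri≈ _ e _ | _ = e
... | tri< s<q+r _ _ | _ , q+r<1 = ⊥-elim (∉ℤ-gap s<q+r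
  (ℚ.<-trans q+r<1 (ℚ.+-monoˡ-< 1ℚ 0<s))
  (≡.subst IsInteger
    (solve 2 (λ s t → :- (s :+ (:- t)) := t :+ (:- s)) ≡.refl s (q ℚ.+ r))
    (integer-neg i)))
  where open +-*-Solver
... | tri> _ _ q+r<s | 0<q+r , _ = ⊥-elim (∉ℤ-gap q+r<s
  (ℚ.<-trans (ℚ.<-trans s<½ ½<1) (ℚ.+-monoˡ-< 1ℚ 0<q+r)) i)

floor-≤ : ∀ q → fromℤ (ℚ.floor q) ℚ.≤ q
floor-≤ q@record{} = ℚ.*≤* (≡.subst (ℚ.floor q ℤ.* ℚ.↧ q ℤ.≤_)
  (≡.sym (ℤ.*-identityʳ (ℚ.↥ q))) (ℤ.[n/d]*d≤n (ℚ.↥ q) (ℚ.↧ q)))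

<-floor+1 : ∀ q → q ℚ.< fromℤ (ℚ.floor q) ℚ.+ 1ℚ
<-floor+1 q@record{} = ≡.subst (q ℚ.<_)
  (≡.sym (≡.trans (fromℤ-+ (ℚ.floor q) (+ 1))
    (≡.cong fromℤ (ℤ.+-comm (ℚ.floor q) (+ 1)))))
  (ℚ.*<* (≡.subst₂ ℤ._<_ (≡.sym (ℤ.*-identityʳ (ℚ.↥ q)))
    (≡.cong (λ f → ℤ.suc f ℤ.* ℚ.↧ q) (≡.sym (ℤ.div-pos-is-/ℕ (ℚ.↥ q) (ℚ.↧ₙ q))))
    (ℤ.n<s[n/ℕd]*d (ℚ.↥ q) (ℚ.↧ₙ q))))

-- The circle ℚ/ℤ is cut at 0 and ½. In `upper` the representative is taken between -½ and 0, so
-- that negation exchanges the two open halves.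
data Residue (q : ℚ) : Set where
  integer : IsInteger q → Residue q
  lower   : ∀ r → IsInteger (q ℚ.- r) → InLowerHalf r → Residue q
  upper   : ∀ r → IsInteger (q ℚ.- r) → InLowerHalf (ℚ.- r) → Residue q
  middle  : IsInteger (q ℚ.- ½) → Residue q

residue : ∀ q → Residue q
residue q with ℚ.<-cmp (q ℚ.- fromℤ (ℚ.floor q)) 0ℚ | ℚ.<-cmp (q ℚ.- fromℤ (ℚ.floor q)) ½
... | tri< r<0 _ _ | _ = ⊥-elim (ℚ.<-irrefl ≡.refl (ℚ.<-≤-trans r<0 0≤r))
  where
  0≤r : 0ℚ ℚ.≤ q ℚ.- fromℤ (ℚ.floor q)
  0≤r = ≡.subst (ℚ._≤ q ℚ.- fromℤ (ℚ.floor q)) (ℚ.+-inverseʳ (fromℤ (ℚ.floor q)))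
          (ℚ.+-monoˡ-≤ (ℚ.- fromℤ (ℚ.floor q)) (floor-≤ q))
... | tri≈ _ r≡0 _ | _ = integer (ℚ.floor q , ≡.trans
    (solve 2 (λ q f → q := (q :+ (:- f)) :+ f) ≡.refl q (fromℤ (ℚ.floor q)))
    (≡.trans (≡.cong (ℚ._+ fromℤ (ℚ.floor q)) r≡0) (ℚ.+-identityˡ _)))
  where open +-*-Solver
... | tri> _ _ 0<r | tri< r<½ _ _ = lower (q ℚ.- f) (ℚ.floor q ,
    solve 2 (λ q f → q :+ (:- (q :+ (:- f))) := f) ≡.refl q f) (0<r , r<½)
  where
  open +-*-Solver
  f = fromℤ (ℚ.floor q)
... | tri> _ _ 0<r | tri≈ _ r≡½ _ = middle (ℚ.floor q , ≡.trans
    (≡.cong (λ h → q ℚ.- h) (≡.sym r≡½))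
    (solve 2 (λ q f → q :+ (:- (q :+ (:- f))) := f) ≡.refl q (fromℤ (ℚ.floor q))))
  where open +-*-Solver
-- The fractional part lies between ½ and 1; subtracting one more than the floor moves it to the
-- interval from -½ to 0.
... | tri> _ _ 0<r | tri> _ _ ½<r = upper (q ℚ.- (f ℚ.+ 1ℚ))
  (≡.subst IsInteger (≡.sym (solve 2 (λ q g → q :+ (:- (q :+ (:- g))) := g) ≡.refl q (f ℚ.+ 1ℚ)))
    (_ , fromℤ-+ (ℚ.floor q) (+ 1)))
  ( ≡.subst₂ ℚ._<_ (ℚ.+-inverseʳ q)
      (solve 2 (λ q g → g :+ (:- q) := :- (q :+ (:- g))) ≡.refl q (f ℚ.+ 1ℚ))
      (ℚ.+-monoˡ-< (ℚ.- q) (<-floor+1 q))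
  , ≡.subst₂ ℚ._<_
      (solve 3 (λ q f i → :- (q :+ (:- f)) :+ i := :- (q :+ (:- (f :+ i)))) ≡.refl q f 1ℚ)
      ≡.refl
      (ℚ.+-monoˡ-< 1ℚ (ℚ.neg-antimono-< ½<r)))
  where
  open +-*-Solver
  f = fromℤ (ℚ.floor q)

×-fromℤ : ∀ n q → n ℚ+.× q ≡ fromℤ (+ n) ℚ.* q
×-fromℤ zero    q = ≡.sym (ℚ.*-zeroˡ q)
×-fromℤ (suc n) q = ≡.trans (≡.cong (q ℚ.+_) (×-fromℤ n q)) (≡.trans
  (solve 3 (λ q f i → q :+ f :* q := (con 1ℚ :+ f) :* q) ≡.refl q (fromℤ (+ n)) 1ℚ)
  (≡.cong (ℚ._* q) (fromℤ-+ (+ 1) (+ n))))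
  where open +-*-Solver

1/suc : ℕ → ℚ
1/suc k = ℚ.1/ fromℤ (+ suc k)

×-1/suc : ∀ k q → suc k ℚ+.× (1/suc k ℚ.* q) ≡ q
×-1/suc k q = ≡.trans (×-fromℤ (suc k) (1/suc k ℚ.* q)) (≡.trans
  (≡.sym (ℚ.*-assoc (fromℤ (+ suc k)) (1/suc k) q))
  (≡.trans (≡.cong (ℚ._* q) (ℚ.*-inverseʳ (fromℤ (+ suc k)))) (ℚ.*-identityˡ q)))

-- In lowest terms the denominator is k + 2, whereas that of an integer is 1.
1/2+∉ℤ : ∀ k → ¬ IsInteger (1/suc (suc k) ℚ.* 1ℚ)
1/2+∉ℤ k (z , e) with ≡.cong ℚ.ℚ.denominator-1 (≡.trans (≡.sym (ℚ.*-identityʳ (1/suc (suc k)))) e)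
... | ()

×-mono-≤ : ∀ n {q r} → q ℚ.≤ r → n ℚ+.× q ℚ.≤ n ℚ+.× r
×-mono-≤ zero    q≤r = ℚ.≤-refl
×-mono-≤ (suc n) q≤r = ℚ.+-mono-≤ q≤r (×-mono-≤ n q≤r)

-- A positive fraction is at least the reciprocal of its denominator d + 1, so d + 1 summands
-- suffice.
archimedean : ∀ {q} → 0ℚ ℚ.< q → ∃[ n ] 1ℚ ℚ.≤ n ℚ+.× q
archimedean {mkℚ (+ suc a) d c} _ = suc d , ≡.subst (ℚ._≤ suc d ℚ+.× mkℚ (+ suc a) d c)
  (≡.trans (≡.cong (suc d ℚ+.×_) (≡.sym (ℚ.*-identityʳ (1/suc d)))) (×-1/suc d 1ℚ))
  (×-mono-≤ (suc d) {1/suc d} {mkℚ (+ suc a) d c} (ℚ.*≤*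
    (ℤ.*-monoʳ-≤-nonNeg (+ suc d) {+ 1} {+ suc a} (ℤ.+≤+ (ℕ.s≤s ℕ.z≤n)))))
archimedean {mkℚ (+ zero) d c} (ℚ.*<* (ℤ.+<+ ()))
archimedean {mkℚ -[1+ n ] d c} (ℚ.*<* ())

-- Partial characters

least : ExcludedMiddle ℓ → (P : ℕ → Set ℓ) → ∀ n → P n →
        ∃[ k ] P k × (∀ j → j ℕ.< k → ¬ P j)
least em P = <-rec _ step
  where
  step : ∀ n → (∀ {m} → m ℕ.< n → P m → ∃[ k ] P k × (∀ j → j ℕ.< k → ¬ P j)) →
         P n → ∃[ k ] P k × (∀ j → j ℕ.< k → ¬ P j)
  step n rec Pn with em {∃[ m ] m ℕ.< n × P m}
  ... | yes (m , m<n , Pm) = rec m<n Pm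
  ... | no none            = n , Pn , λ j j<n Pj → none (j , j<n , Pj)

-- Adjoining an element to a subgroup

module _ (H : AbelianGroup ℓ ℓ) where
  open AbelianGroup H
  open AbelianGroupProperties H using (∙-cancelʳ)
  open CommutativeSemigroupProperties commutativeSemigroup using (interchange)
  open Mult commutativeMonoid using (×-homo-+; ×-assocˡ) renaming (_×_ to _·_)

  record Subgroup : Set (lsuc ℓ) where
    field
      contains  : Pred Carrier ℓ
      resp      : contains Respects _≈_
      closed-ε  : contains ε
      closed-∙  : ∀ {z w} → contains z → contains w → contains (z ∙ w)
      closed-⁻¹ : ∀ {z} → contains z → contains (z ⁻¹)

    closed-· : ∀ n {z} → contains z → contains (n · z)
    closed-· zero    _  = closed-ε
    closed-· (suc n) z∈ = closed-∙ z∈ (closed-· n z∈)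

    -- Division of `n` by k + 1 with remainder: multiples of (k + 1) c lie in the subgroup and can
    -- be removed.
    reduce-multiple : ∀ {z c} n k → contains (suc k · c) → contains (z ∙ n · c) →
                      contains (z ∙ (n ℕ.% suc k) · c)
    reduce-multiple {z} {c} n k kc∈ znc∈ = resp
      (trans (∙-congʳ (trans (∙-congˡ split) (sym (assoc _ _ _))))
        (trans (assoc _ _ _) (trans (∙-congˡ (inverseʳ _)) (identityʳ _))))
      (closed-∙ znc∈ (closed-⁻¹ (closed-· (n ℕ./ suc k) kc∈)))
      where
      split : n · c ≈ (n ℕ.% suc k) · c ∙ (n ℕ./ suc k) · (suc k · c)
      split = trans (reflexive (≡.cong (_· c) (ℕ.m≡m%n+[m/n]*n n (suc k))))
        (trans (×-homo-+ c (n ℕ.% suc k) (n ℕ./ suc k ℕ.* suc k))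
          (∙-congˡ (sym (×-assocˡ c (n ℕ./ suc k) (suc k)))))

  open Subgroup

  private
    invert : ∀ z w {u v} → z ∙ u ≈ w ∙ v → z ⁻¹ ∙ v ≈ w ⁻¹ ∙ u
    invert z w {u} {v} e = ∙-cancelʳ (z ∙ w) _ _ (trans
      (trans (interchange (z ⁻¹) v z w) (trans (∙-cong (inverseˡ z) (comm v w)) (identityˡ _)))
      (sym (trans (∙-congˡ (comm z w)) (trans (interchange (w ⁻¹) u w z)
        (trans (∙-cong (inverseˡ w) (comm u z)) (trans (identityˡ _) e))))))

    split-multiple : ∀ {m n} c → m ℕ.≤ n → n · c ≈ (n ℕ.∸ m) · c ∙ m · c
    split-multiple {m} {n} c m≤n =
      trans (reflexive (≡.cong (_· c) (≡.sym (ℕ.m∸n+n≡m m≤n)))) (×-homo-+ c (n ℕ.∸ m) m)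

  -- The subgroup generated by `K` and `c`. An integer multiple of `c` is written as a difference of
  -- natural multiples, one on each side of the equation.
  join : Subgroup → Carrier → Subgroup
  join K c = record
    { contains  = λ z → ∃[ m ] ∃[ n ] ∃[ w ] contains K w × z ∙ m · c ≈ w ∙ n · c
    ; resp      = λ z≈z′ (m , n , w , w∈ , e) →
                    m , n , w , w∈ , trans (∙-congʳ (sym z≈z′)) e
    ; closed-ε  = 0 , 0 , ε , closed-ε K , refl
    ; closed-∙  = λ {z} {z′} (m , n , w , w∈ , e) (m′ , n′ , w′ , w′∈ , e′) →
        m ℕ.+ m′ , n ℕ.+ n′ , w ∙ w′ , closed-∙ K w∈ w′∈ ,
        trans (distribute z z′ m m′) (trans (∙-cong e e′) (sym (distribute w w′ n n′)))
    ; closed-⁻¹ = λ {z} (m , n , w , w∈ , e) → n , m , w ⁻¹ , closed-⁻¹ K w∈ , invert z w e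
    }
    where
    distribute : ∀ z z′ m m′ →
      (z ∙ z′) ∙ (m ℕ.+ m′) · c ≈ (z ∙ m · c) ∙ (z′ ∙ m′ · c)
    distribute z z′ m m′ =
      trans (∙-congˡ (×-homo-+ c m m′)) (interchange z z′ (m · c) (m′ · c))

  join-⊇ : ∀ K c {z} → contains K z → contains (join K c) z
  join-⊇ K c {z} z∈ = 0 , 0 , z , z∈ , refl

  join-∋ : ∀ K c → contains (join K c) c
  join-∋ K c = 0 , 1 , ε , closed-ε K ,
    trans (identityʳ c) (sym (trans (identityˡ _) (identityʳ c)))

  -- Only the difference of the two multiples matters; according to its sign, `z` or its inverse is
  -- paired with a natural multiple, ready for division with remainder.
  join-elim : ∀ K c {z} → contains (join K c) z →
    ∃[ n ] (contains K (z ∙ n · c) ⊎ contains K (z ⁻¹ ∙ n · c))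
  join-elim K c {z} (m , n , w , w∈ , e) with ℕ.≤-total n m
  ... | inj₁ n≤m = m ℕ.∸ n , inj₁ (resp K (∙-cancelʳ (n · c) _ _
    (trans (sym e) (trans (∙-congˡ (split-multiple c n≤m)) (sym (assoc _ _ _))))) w∈)
  ... | inj₂ m≤n = n ℕ.∸ m , inj₂ (resp K
    (trans (sym (identityʳ _)) (sym (invert z w (trans (identityʳ z)
      (∙-cancelʳ (m · c) _ _ (trans e (trans (∙-congˡ (split-multiple c m≤n))
        (sym (assoc _ _ _)))))))))
    (closed-⁻¹ K w∈))

module _ (G : AbelianGroup ℓ ℓ) where
  private
    module G = AbelianGroup G
    module G× = Mult G.commutativeMonoid
    module ℚ× = Mult (AbelianGroup.commutativeMonoid ℚ.+-0-abelianGroup)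

    G×ℚ : AbelianGroup ℓ ℓ
    G×ℚ = DirectProduct.abelianGroup G ℚ.+-0-abelianGroup

  open AbelianGroup G×ℚ using (Carrier; _∙_; _≈_)
  open Mult (AbelianGroup.commutativeMonoid G×ℚ) using () renaming (_×_ to _·_)

  -- A homomorphism from a subgroup of G to ℚ/ℤ, given by the preimage in G × ℚ
  -- of its graph.
  record PartialCharacter : Set (lsuc ℓ) where
    field
      subgroup    : Subgroup G×ℚ
      integer⇒ε   : ∀ {q} → IsInteger q → Subgroup.contains subgroup (G.ε , q)
      ε⇒integer   : ∀ {q} → Subgroup.contains subgroup (G.ε , q) → IsInteger q

    open Subgroup subgroup public renaming (contains to graph)

    unique : ∀ {a q r} → graph (a , q) → graph (a , r) → IsInteger (q ℚ.- r)
    unique {a} gq gr =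
      ε⇒integer (resp (G.inverseʳ a , ≡.refl) (closed-∙ gq (closed-⁻¹ gr)))

    shift : ∀ {a q r} → graph (a , q) → IsInteger (q ℚ.- r) → graph (a , r)
    shift {a} {q} {r} gq i = resp
      ( G.trans (G.∙-congˡ ε⁻¹≈ε) (G.identityʳ a)
      , solve 2 (λ q r → q :+ (:- (q :+ (:- r))) := r) ≡.refl q r)
      (closed-∙ gq (closed-⁻¹ (integer⇒ε i)))
      where
      open +-*-Solver
      open AbelianGroupProperties G using (ε⁻¹≈ε)

  open PartialCharacter

  -- Exchanges the two halves of the circle, which reduces every argument to the lower half.
  negation : PartialCharacter → PartialCharacter
  negation χ = record
    { subgroup = record
      { contains  = λ (a , q) → graph χ (a , ℚ.- q)
      ; resp      = λ (e , e′) → resp χ (e , ≡.cong ℚ.-_ e′)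
      ; closed-ε  = closed-ε χ
      ; closed-∙  = λ {z} {w} gz gw → resp χ
          (G.refl , ≡.sym (ℚ.neg-distrib-+ (proj₂ z) (proj₂ w))) (closed-∙ χ gz gw)
      ; closed-⁻¹ = closed-⁻¹ χ
      }
    ; integer⇒ε = λ i → integer⇒ε χ (integer-neg i)
    ; ε⇒integer = λ {q} gq → integer-neg⁻¹ (ε⇒integer χ gq)
    }

  -- This keeps the values over the identity integral after `c` is adjoined; negative multiples of
  -- `c` are covered by replacing q by -q.
  Consistent : PartialCharacter → Carrier → Set ℓ
  Consistent χ c = ∀ n q → graph χ ((G.ε , q) ∙ n · c) → IsInteger q

  extend : (χ : PartialCharacter) (c : Carrier) → Consistent χ c → PartialCharacter
  extend χ c consistent = record
    { subgroup  = join G×ℚ (subgroup χ) c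
    ; integer⇒ε = λ i → join-⊇ G×ℚ (subgroup χ) c (integer⇒ε χ i)
    ; ε⇒integer = λ {q} gq → integral q (join-elim G×ℚ (subgroup χ) c {G.ε , q} gq)
    }
    where
    open AbelianGroupProperties G using (ε⁻¹≈ε)
    integral : ∀ q → ∃[ n ] (graph χ ((G.ε , q) ∙ n · c) ⊎ graph χ ((G.ε G.⁻¹ , ℚ.- q) ∙ n · c)) →
               IsInteger q
    integral q (n , inj₁ gq) = consistent n q gq
    integral q (n , inj₂ gq) = integer-neg⁻¹ (consistent n (ℚ.- q)
      (resp χ (G.∙-congʳ ε⁻¹≈ε , ≡.refl) gq))

  infix 4 _⊑_
  _⊑_ : PartialCharacter → PartialCharacter → Set ℓ
  χ ⊑ ψ = ∀ {z} → graph χ z → graph ψ z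

  ⊑-extend : ∀ χ c k → χ ⊑ extend χ c k
  ⊑-extend χ c k = join-⊇ G×ℚ (subgroup χ) c

  extend-∋ : ∀ χ c k → graph (extend χ c k) c
  extend-∋ χ c k = join-∋ G×ℚ (subgroup χ) c

  proj₁-· : ∀ n g v → proj₁ (n · (g , v)) ≡ n G×.× g
  proj₁-· zero    g v = ≡.refl
  proj₁-· (suc n) g v = ≡.cong (g G.∙_) (proj₁-· n g v)

  proj₂-· : ∀ n g v → proj₂ (n · (g , v)) ≡ n ℚ×.× v
  proj₂-· zero    g v = ≡.refl
  proj₂-· (suc n) g v = ≡.cong (v ℚ.+_) (proj₂-· n g v)

  module _ (em : ExcludedMiddle ℓ) where

    -- Either no positive multiple of g is in the domain and any value will do,
    -- or the value of the least one has to be divided.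
    consistent-values : ∀ χ g →
      (∀ v → Consistent χ (g , v)) ⊎
      (∃[ k ] (∃[ r ] graph χ (suc k G×.× g , r)) ×
              (∀ {r} → graph χ (suc k G×.× g , r) → Consistent χ (g , 1/suc k ℚ.* r)))
    consistent-values χ g with em {∃[ k ] ∃[ r ] graph χ (suc k G×.× g , r)}
    ... | no none = inj₁ consistent
      where
      consistent : ∀ v → Consistent χ (g , v)
      consistent v zero    q gq = ε⇒integer χ (resp χ (G.identityʳ _ , ℚ.+-identityʳ _) gq)
      consistent v (suc n) q gq = ⊥-elim (none (n , _ , resp χ
        (G.trans (G.identityˡ _) (G.reflexive (proj₁-· (suc n) g v)) , ≡.refl) gq))
    ... | yes (n , Pn) with least em (λ k → ∃[ r ] graph χ (suc k G×.× g , r)) n Pn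
    ... | k , Pk , below = inj₂ (k , Pk , consistent)
      where
      module _ {r} (gr : graph χ (suc k G×.× g , r)) where
        v = 1/suc k ℚ.* r
        c = g , v

        multiple : graph χ (suc k · c)
        multiple = resp χ (G.sym (G.reflexive (proj₁-· (suc k) g v)) ,
          ≡.sym (≡.trans (proj₂-· (suc k) g v) (×-1/suc k r))) gr

        -- By minimality of `k`, the remainder can only be 0: no positive multiple of g below the (k
        -- + 1)-st is in the domain.
        small : ∀ ρ → ρ ℕ.< suc k → ∀ q → graph χ ((G.ε , q) ∙ ρ · c) → IsInteger q
        small zero    _         q gq = ε⇒integer χ (resp χ (G.identityʳ _ , ℚ.+-identityʳ _) gq)
        small (suc ρ) (ℕ.s≤s ρ<k) q gq = ⊥-elim (below ρ ρ<k (_ , resp χ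
          (G.trans (G.identityˡ _) (G.reflexive (proj₁-· (suc ρ) g v)) , ≡.refl) gq))

        consistent : Consistent χ c
        consistent n q gq = small (n ℕ.% suc k) (ℕ.m%n<n n (suc k)) q
          (reduce-multiple χ {G.ε , q} {c} n k multiple gq)

    adjoin : ∀ χ g → ∃[ ψ ] χ ⊑ ψ × ∃[ v ] graph ψ (g , v)
    adjoin χ g with consistent-values χ g
    ... | inj₁ any = extend χ c (any 0ℚ) , ⊑-extend χ c (any 0ℚ) , 0ℚ , extend-∋ χ c (any 0ℚ)
      where c = g , 0ℚ
    ... | inj₂ (k , (r , gr) , divide) =
      extend χ c (divide gr) , ⊑-extend χ c (divide gr) , 1/suc k ℚ.* r , extend-∋ χ c (divide gr)
      where c = g , 1/suc k ℚ.* r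

    trivial : PartialCharacter
    trivial = record
      { subgroup = record
        { contains  = λ (a , q) → a G.≈ G.ε × IsInteger q
        ; resp      = λ (e , e′) (a≈ε , i) → G.trans (G.sym e) a≈ε , ≡.subst IsInteger e′ i
        ; closed-ε  = G.refl , integer-0
        ; closed-∙  = λ (e , i) (e′ , i′) → G.trans (G.∙-cong e e′) (G.identityˡ _) , integer-+ i i′
        ; closed-⁻¹ = λ (e , i) → G.trans (G.⁻¹-cong e) ε⁻¹≈ε , integer-neg i
        }
      ; integer⇒ε = λ i → G.refl , i
      ; ε⇒integer = proj₂
      }
      where open AbelianGroupProperties G using (ε⁻¹≈ε)

    -- If no positive multiple of g vanishes, the value ½ is allowed. If the (k + 2)-fold multiple
    -- does, its value is represented by 1 rather than 0, and division gives 1/(k + 2).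
    nonvanishing : ∀ g → ¬ g G.≈ G.ε → ∃[ χ ] ∃[ v ] graph χ (g , v) × ¬ IsInteger v
    nonvanishing g g≉ε with consistent-values trivial g
    ... | inj₁ any = extend trivial (g , ½) (any ½) , ½ , extend-∋ trivial (g , ½) (any ½) , ½∉ℤ
    ... | inj₂ (zero , (_ , g≈ε , _) , _) =
      ⊥-elim (g≉ε (G.trans (G.sym (G.identityʳ g)) g≈ε))
    ... | inj₂ (suc k , (_ , kg≈ε , _) , divide) =
      extend trivial (g , v) C , v , extend-∋ trivial (g , v) C , 1/2+∉ℤ k
      where
      v = 1/suc (suc k) ℚ.* 1ℚ
      C = divide (kg≈ε , integer-1)

    module _ (χ : PartialCharacter) (x : ℕ → G.Carrier) where
      chain : ℕ → PartialCharacter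
      chain zero    = χ
      chain (suc n) = proj₁ (adjoin (chain n) (x n))

      chain-step : ∀ n → chain n ⊑ chain (suc n)
      chain-step n = proj₁ (proj₂ (adjoin (chain n) (x n)))

      chain-mono : ∀ n d → chain n ⊑ chain (d ℕ.+ n)
      chain-mono n zero    gz = gz
      chain-mono n (suc d) gz = chain-step (d ℕ.+ n) (chain-mono n d gz)

      limit : PartialCharacter
      limit = record
        { subgroup = record
          { contains  = λ z → ∃[ n ] graph (chain n) z
          ; resp      = λ e (n , gz) → n , resp (chain n) e gz
          ; closed-ε  = 0 , closed-ε χ
          ; closed-∙  = λ {z} {w} (m , gz) (n , gw) → m ℕ.+ n , closed-∙ (chain (m ℕ.+ n))
              (≡.subst (λ k → graph (chain k) z) (ℕ.+-comm n m) (chain-mono m n gz))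
              (chain-mono n m gw)
          ; closed-⁻¹ = λ (n , gz) → n , closed-⁻¹ (chain n) gz
          }
        ; integer⇒ε = λ i → 0 , integer⇒ε χ i
        ; ε⇒integer = λ (n , gq) → ε⇒integer (chain n) gq
        }

      adjoin-sequence : ∃[ ψ ] χ ⊑ ψ × (∀ n → ∃[ v ] graph ψ (x n , v))
      adjoin-sequence = limit , (λ gz → 0 , gz) ,
        λ n → let v , gv = proj₂ (proj₂ (adjoin (chain n) (x n))) in v , suc n , gv

    -- The value at g is fixed first and survives the adjunction of the sequence. The implication
    -- provides a character for every g, so that a whole sequence of them can be indexed by ℕ.
    separating-character : ∀ x g → ∃[ χ ]
      (∀ n → ∃[ v ] graph χ (x n , v)) ×
      (¬ g G.≈ G.ε → ∃[ v ] graph χ (g , v) × ¬ IsInteger v)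
    separating-character x g with em {g G.≈ G.ε}
    ... | yes g≈ε = let χ , _ , total = adjoin-sequence trivial x
                    in χ , total , λ g≉ε → ⊥-elim (g≉ε g≈ε)
    ... | no  g≉ε =
      let χ , v , gv , v∉ℤ = nonvanishing g g≉ε
          ψ , χ⊑ψ , total  = adjoin-sequence χ x
      in ψ , total , λ _ → v , χ⊑ψ gv , v∉ℤ

  product-value : ∀ χ x → (∀ n → ∃[ v ] graph χ (x n , v)) →
                  ∀ b → ∃[ v ] graph χ (product G.semigroup x b , v)
  product-value χ x total zero     = total 0
  product-value χ x total 2[1+ b ] =
    let v , gv = total 0
        w , gw = product-value χ (x ∘ suc) (total ∘ suc) b
    in v ℚ.+ w , closed-∙ χ gv gw
  product-value χ x total 1+[2 b ] = product-value χ (x ∘ suc) (total ∘ suc) b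

-- Abelian groups

module _ (G : AbelianGroup ℓ ℓ) (p : Ultrafilter (AbelianGroup.setoid G))
         (pr : Productive (AbelianGroup.semigroup G) p) where
  open AbelianGroup G
  open AbelianGroupProperties G using (ε⁻¹≈ε; xyx⁻¹≈y)
  open CommutativeSemigroupProperties commutativeSemigroup
    using (interchange; xy∙z≈y∙xz; x∙yz≈y∙xz)
  open PartialCharacter
  open Ultrafilter p using (⊆-large; ∩-large; ultra)
  private
    S = semigroup
    module ℚ× = Mult (AbelianGroup.commutativeMonoid ℚ.+-0-abelianGroup)

    em : ExcludedMiddle ℓ
    em = productive⇒em p pr

  kernelOf : PartialCharacter G → Subset setoid
  kernelOf χ = record
    { member   = λ z → graph χ (z , 0ℚ)
    ; respects = λ e → resp χ (e , ≡.refl)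
    }

  lowerSet : PartialCharacter G → Subset setoid
  lowerSet χ = record
    { member   = λ z → ∃[ q ] graph χ (z , q) × InLowerHalf q
    ; respects = λ e (q , gq , q∈) → q , resp χ (e , ≡.refl) gq , q∈
    }

  middleSet : PartialCharacter G → Subset setoid
  middleSet χ = record
    { member   = λ z → graph χ (z , ½)
    ; respects = λ e → resp χ (e , ≡.refl)
    }

  -- Values are determined only modulo ℤ; in the absence of a carry they add as rationals.
  lower-∙ : ∀ (χ : PartialCharacter G) {s t q r} →
    graph χ (s , q) → InLowerHalf q → graph χ (t , r) → InLowerHalf r →
    member (lowerSet χ) (s ∙ t) → graph χ (s ∙ t , q ℚ.+ r) × InLowerHalf (q ℚ.+ r)
  lower-∙ χ gq q∈ gr r∈ (u , gu , u∈)
    with lowerHalf-no-carry q∈ r∈ u∈ (unique χ gu (closed-∙ χ gq gr))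
  ... | ≡.refl = gu , u∈

  -- The values of the products of a sequence whose factors have values at
  -- least q₀ > 0 would grow beyond ½.
  lower-unbounded : ∀ χ {q₀} → 0ℚ ℚ.< q₀ → ∀ y →
    ¬ (∀ b → ∃[ q ] graph χ (product S y b , q) × InLowerHalf q × q₀ ℚ.≤ q)
  lower-unbounded χ {q₀} 0<q₀ y values =
    let n , 1≤n  = archimedean 0<q₀
        b , q , _ , (_ , q<½) , n≤q = accumulate n y values
    in ℚ.<-irrefl ≡.refl (ℚ.<-≤-trans (ℚ.<-trans q<½ ½<1) (ℚ.≤-trans 1≤n n≤q))
    where
    accumulate : ∀ n y →
      (∀ b → ∃[ q ] graph χ (product S y b , q) × InLowerHalf q × q₀ ℚ.≤ q) →
      ∃[ b ] ∃[ q ] graph χ (product S y b , q) × InLowerHalf q × n ℚ×.× q₀ ℚ.≤ q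
    accumulate zero y values =
      let q , gq , q∈ , _ = values zero in zero , q , gq , q∈ , ℚ.<⇒≤ (proj₁ q∈)
    accumulate (suc n) y values =
      let q , gq , q∈ , q₀≤q    = values zero
          b , r , gr , r∈ , n≤r = accumulate n (y ∘ suc) (λ b → values 1+[2 b ])
          s , gs , s∈ , _       = values 2[1+ b ]
          gqr , qr∈             = lower-∙ χ gq q∈ gr r∈ (s , gs , s∈)
      in 2[1+ b ] , q ℚ.+ r , gqr , qr∈ , ℚ.+-mono-≤ q₀≤q n≤r

  -- The values on the translate are sums q₀ + q without carry, with q₀ the value of x₀. A sequence
  -- with all products in a large translate would contradict `lower-unbounded`.
  lowerSet-regular : ∀ χ → large p (lowerSet χ) → Regular S p
  lowerSet-regular χ L∈p = lowerSet χ , L∈p , λ x x⊆L tr∈p →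
    let y , y⊆tr , _  = pr tr∈p
        q₀ , g₀ , q₀∈ = x⊆L zero
    in lower-unbounded χ (proj₁ q₀∈) y λ b →
      let t , (c , e) , e′ = y⊆tr b
          q , gq , q∈      = x⊆L 1+[2 c ]
          gs , s∈          = lower-∙ χ g₀ q₀∈ gq q∈ (x⊆L 2[1+ c ])
      in q₀ ℚ.+ q , resp χ (trans (∙-congˡ e) e′ , ≡.refl) gs , s∈
       , ≡.subst (ℚ._≤ q₀ ℚ.+ q) (ℚ.+-identityʳ q₀) (ℚ.+-monoʳ-≤ q₀ (ℚ.<⇒≤ (proj₁ q∈)))

  -- Two factors of value ½ have a product of value 0, not ½, modulo ℤ.
  middleSet-small : ∀ χ → ¬ large p (middleSet χ)
  middleSet-small χ M∈p =
    let y , y⊆M , _ = pr M∈p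
    in ½∉ℤ (unique χ (closed-∙ χ (y⊆M zero) (y⊆M 1+[2 zero ])) (y⊆M 2[1+ zero ]))

  opposite : ∀ (χ : PartialCharacter G) {s t a} →
    graph χ (s ∙ t , 0ℚ) → graph χ (s , a) → graph χ (t , ℚ.- a)
  opposite χ {s} {t} {a} gst gs =
    resp χ (xyx⁻¹≈y s t , ℚ.+-identityˡ (ℚ.- a)) (closed-∙ χ gst (closed-⁻¹ χ gs))

  square-nonzero : ∀ (χ : PartialCharacter G) {s q} →
    graph χ (s , q) → InLowerHalf q → ¬ graph χ (s ∙ s , 0ℚ)
  square-nonzero χ gq q∈ gss = lowerHalf-+∉ℤ q∈ q∈
    (≡.subst IsInteger (ℚ.+-identityʳ _) (unique χ (closed-∙ χ gq gq) gss))

  -- The index j is the first one with χⱼ(z²) ≠ 0, since a value in the lower half has a nonzero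
  -- double. Squares are taken because 0 and ½ lie in neither half.
  firstLowerSet : (ℕ → PartialCharacter G) → Subset setoid
  firstLowerSet χ = record
    { member   = λ z → ∃[ j ] (∀ i → i ℕ.< j → graph (χ i) (z ∙ z , 0ℚ)) × member (lowerSet (χ j)) z
    ; respects = λ e (j , before , l) →
        j , (λ i i<j → resp (χ i) (∙-cong e e , ≡.refl) (before i i<j)) ,
        respects (lowerSet (χ j)) e l
    }

  -- If s ∙ t is in the kernels of χ₀, …, χⱼ, then s and t have opposite values
  -- under them, which cannot both lie in the lower half.
  firstLowerSet-regular : (χ : ℕ → PartialCharacter G) → (∀ j → large p (kernelOf (χ j))) →
    large p (firstLowerSet χ) → Regular S p
  firstLowerSet-regular χ kernels F∈p = firstLowerSet χ , F∈p , λ x x⊆F tr∈p →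
    let j , before , low = x⊆F zero
        z , (t , (c , e) , e′) , z∈ker = productive⇒inhabited p pr
          (∩-large {A = translate S (x 0) (Products S (x ∘ suc))} tr∈p (kernels-≤ j))
    in clash j before low (respects (firstLowerSet χ) e (x⊆F 1+[2 c ]))
         (λ i i≤j → resp (χ i) (sym e′ , ≡.refl) (z∈ker i i≤j))
    where
    Kernels-≤ : ℕ → Subset setoid
    Kernels-≤ j = record
      { member   = λ z → ∀ i → i ℕ.≤ j → graph (χ i) (z , 0ℚ)
      ; respects = λ e k i i≤j → resp (χ i) (e , ≡.refl) (k i i≤j)
      }

    kernels-≤ : ∀ j → large p (Kernels-≤ j)
    kernels-≤ zero    = ⊆-large {kernelOf (χ 0)} {Kernels-≤ 0}
      (λ k → λ { zero _ → k }) (kernels 0)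
    kernels-≤ (suc j) = ⊆-large {Kernels-≤ j ∩ kernelOf (χ (suc j))} {Kernels-≤ (suc j)}
      both (∩-large (kernels-≤ j) (kernels (suc j)))
      where
      both : ∀ {z} → member (Kernels-≤ j ∩ kernelOf (χ (suc j))) z → member (Kernels-≤ (suc j)) z
      both (ks , k) i i≤sj with ℕ.m≤n⇒m<n∨m≡n i≤sj
      ... | inj₁ (ℕ.s≤s i≤j) = ks i i≤j
      ... | inj₂ ≡.refl      = k

    square : ∀ i {s t} → graph (χ i) (s ∙ t , 0ℚ) → graph (χ i) ((s ∙ s) ∙ (t ∙ t) , 0ℚ)
    square i {s} {t} g = resp (χ i) (interchange s t s t , ≡.refl) (closed-∙ (χ i) g g)

    -- If the first indices of s and t differ, then at the smaller one the square of one factor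
    -- vanishes, hence so does that of the other, which was nonzero. At a common index two
    -- lower-half values would sum to an integer.
    clash : ∀ {s t} j → (∀ i → i ℕ.< j → graph (χ i) (s ∙ s , 0ℚ)) → member (lowerSet (χ j)) s →
      member (firstLowerSet χ) t → ¬ (∀ i → i ℕ.≤ j → graph (χ i) (s ∙ t , 0ℚ))
    clash {s} {t} j before (q , gq , q∈) (k , before′ , r , gr , r∈) st∈ker with ℕ.<-cmp j k
    ... | tri< j<k _ _ = square-nonzero (χ j) gq q∈ (opposite (χ j)
      (resp (χ j) (comm _ _ , ≡.refl) (square j (st∈ker j ℕ.≤-refl))) (before′ j j<k))
    ... | tri> _ _ k<j = square-nonzero (χ k) gr r∈ (opposite (χ k)
      (square k (st∈ker k (ℕ.<⇒≤ k<j))) (before k k<j))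
    ... | tri≈ _ ≡.refl _ = lowerHalf-+∉ℤ q∈ r∈ (≡.subst IsInteger (ℚ.+-identityʳ _)
      (unique (χ j) (closed-∙ (χ j) gq gr) (st∈ker j ℕ.≤-refl)))

  -- Elements whose square is trivial

  involutions : Subset setoid
  involutions = record
    { member   = λ z → z ∙ z ≈ ε
    ; respects = λ e zz≈ε → trans (∙-cong (sym e) (sym e)) zz≈ε
    }

  Span : (ℕ → Carrier) → Carrier → Set ℓ
  Span x s = s ≈ ε ⊎ ∃[ b ] product S x b ≈ s

  span-resp : ∀ {x s t} → s ≈ t → Span x s → Span x t
  span-resp e (inj₁ s≈ε)     = inj₁ (trans (sym e) s≈ε)
  span-resp e (inj₂ (b , q)) = inj₂ (b , trans q e)

  span-head : ∀ {x s} → Span (x ∘ suc) s → Span x (x 0 ∙ s)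
  span-head (inj₁ s≈ε)     = inj₂ (zero , sym (trans (∙-congˡ s≈ε) (identityʳ _)))
  span-head (inj₂ (b , q)) = inj₂ (2[1+ b ] , ∙-congˡ q)

  span-tail : ∀ {x s} → Span (x ∘ suc) s → Span x s
  span-tail (inj₁ s≈ε)     = inj₁ s≈ε
  span-tail (inj₂ (b , q)) = inj₂ (1+[2 b ] , q)

  cancel-square : ∀ {s} t → s ∙ s ≈ ε → s ∙ (s ∙ t) ≈ t
  cancel-square t ss≈ε = trans (sym (assoc _ _ _)) (trans (∙-congʳ ss≈ε) (identityˡ t))

  -- When all squares are trivial, multiplication is symmetric difference of index sets, and `Span`
  -- includes the empty one.
  span-∙ : ∀ x → (∀ n → x n ∙ x n ≈ ε) → ∀ b c → Span x (product S x b ∙ product S x c)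
  span-∙ x sq zero     zero     = inj₁ (sq 0)
  span-∙ x sq zero     2[1+ c ] = inj₂ (1+[2 c ] , sym (cancel-square _ (sq 0)))
  span-∙ x sq zero     1+[2 c ] = inj₂ (2[1+ c ] , refl)
  span-∙ x sq 2[1+ b ] zero     =
    inj₂ (1+[2 b ] , sym (trans (comm _ _) (cancel-square _ (sq 0))))
  span-∙ x sq 2[1+ b ] 2[1+ c ] = span-resp
    (sym (trans (assoc _ _ _) (trans (∙-congˡ (x∙yz≈y∙xz _ _ _)) (cancel-square _ (sq 0)))))
    (span-tail (span-∙ (x ∘ suc) (sq ∘ suc) b c))
  span-∙ x sq 2[1+ b ] 1+[2 c ] =
    span-resp (sym (assoc _ _ _)) (span-head (span-∙ (x ∘ suc) (sq ∘ suc) b c))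
  span-∙ x sq 1+[2 b ] zero     = inj₂ (2[1+ b ] , comm _ _)
  span-∙ x sq 1+[2 b ] 2[1+ c ] =
    span-resp (x∙yz≈y∙xz _ _ _) (span-head (span-∙ (x ∘ suc) (sq ∘ suc) b c))
  span-∙ x sq 1+[2 b ] 1+[2 c ] = span-tail (span-∙ (x ∘ suc) (sq ∘ suc) b c)

  -- A coset x₀ ∙ H of a subgroup H of exponent 2 contains s, t and s ∙ t only
  -- if it equals H.
  involutions-regular : large p involutions → ¬ large p (singleton S ε) → Regular S p
  involutions-regular I∈p ε∉p = involutions ∩ ∁ (singleton S ε) ,
    ∩-large I∈p (large-∁ p (singleton S ε) ε∉p) , λ x x⊆B tr∈p →
    let y , y⊆tr , _          = pr tr∈p
        t₀ , (b₀ , e₀) , e₀′ = y⊆tr zero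
        t₁ , (b₁ , e₁) , e₁′ = y⊆tr 1+[2 zero ]
        t₂ , (b₂ , e₂) , e₂′ = y⊆tr 2[1+ zero ]
        x₀²     = proj₁ (x⊆B zero)
        t₂²     = respects involutions e₂ (proj₁ (x⊆B 1+[2 b₂ ]))
        sq n    = let b , e = factor∈Products S (x ∘ suc) n
                  in respects involutions e (proj₁ (x⊆B 1+[2 b ]))
        -- From (x₀ t₀)(x₀ t₁) ≈ x₀ t₂ and x₀² ≈ ε follows t₀ t₁ ≈ x₀ t₂, and then x₀ ≈ t₀ t₁ t₂.
        t₀t₁≈   = trans (sym (trans (∙-congʳ x₀²) (identityˡ _)))
                    (trans (interchange (x 0) (x 0) t₀ t₁) (trans (∙-cong e₀′ e₁′) (sym e₂′)))
        x₀≈     = trans (∙-congʳ t₀t₁≈) (trans (assoc _ _ _) (trans (∙-congˡ t₂²) (identityʳ _)))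
        x₀∈span = span-resp (trans (∙-cong (∙-cong e₀ e₁) e₂) x₀≈)
                    (span-∙³ (x ∘ suc) sq b₀ b₁ b₂)
    in outside x x⊆B x₀∈span
    where
    span-∙³ : ∀ x → (∀ n → x n ∙ x n ≈ ε) → ∀ b c d →
              Span x ((product S x b ∙ product S x c) ∙ product S x d)
    span-∙³ x sq b c d with span-∙ x sq b c
    ... | inj₁ bc≈ε    = inj₂ (d , sym (trans (∙-congʳ bc≈ε) (identityˡ _)))
    ... | inj₂ (a , e) = span-resp (∙-congʳ e) (span-∙ x sq a d)

    -- If x₀ equals a product of later factors, then x₀ times that product is x₀² ≈ ε, an excluded
    -- element.
    outside : ∀ x → (∀ b → member (involutions ∩ ∁ (singleton S ε)) (product S x b)) →
              ¬ Span (x ∘ suc) (x 0)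
    outside x x⊆B (inj₁ x₀≈ε)    = proj₂ (x⊆B zero) (sym x₀≈ε)
    outside x x⊆B (inj₂ (b , e)) =
      proj₂ (x⊆B 2[1+ b ]) (sym (trans (∙-congˡ e) (proj₁ (x⊆B zero))))

  abelianGroup-regular : Regular S p ⊎ large p (singleton S ε)
  abelianGroup-regular with em {large p (singleton S ε)}
  ... | yes ε∈p = inj₂ ε∈p
  ... | no  ε∉p = inj₁ regular
    where
    Sequence : ∃[ x ] (∀ b → member (whole {X = setoid}) (product S x b)) × large p (Products S x)
    Sequence = pr (Ultrafilter.whole-large p)

    x : ℕ → Carrier
    x = proj₁ Sequence

    x∈p : large p (Products S x)
    x∈p = proj₂ (proj₂ Sequence)

    -- Codes are binary numerals, so `ℕᵇ.fromℕ` enumerates all products; the j-th character is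
    -- chosen for the square of the j-th product.
    element : ℕ → Carrier
    element j = product S x (ℕᵇ.fromℕ j)

    Separating : ∀ j → _
    Separating j = separating-character G em x (element j ∙ element j)

    χ : ℕ → PartialCharacter G
    χ j = proj₁ (Separating j)

    value : ∀ j {z} → member (Products S x) z → ∃[ v ] graph (χ j) (z , v)
    value j (b , e) =
      let v , gv = product-value G (χ j) x (proj₁ (proj₂ (Separating j))) b
      in v , resp (χ j) (e , ≡.refl) gv

    kernel-zero : ∀ j {z v} → graph (χ j) (z , v) → IsInteger v → graph (χ j) (z , 0ℚ)
    kernel-zero j gv i = shift (χ j) gv (≡.subst IsInteger (≡.sym (ℚ.+-identityʳ _)) i)

    module _ (j : ℕ) (small : ¬ large p (kernelOf (χ j))) where
      classify : ∀ {z} → member (∁ (kernelOf (χ j)) ∩ Products S x) z →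
        member (lowerSet (χ j)) z ⊎
        (member (lowerSet (negation G (χ j))) z ⊎ member (middleSet (χ j)) z)
      classify (z∉ker , z∈x) with value j z∈x
      ... | v , gv with residue v
      ... | integer i    = ⊥-elim (z∉ker (kernel-zero j gv i))
      ... | lower r i r∈ = inj₁ (r , shift (χ j) gv i , r∈)
      ... | upper r i r∈ = inj₂ (inj₁ (ℚ.- r ,
        resp (χ j) (refl , ≡.sym (neg-involutive r)) (shift (χ j) gv i) , r∈))
      ... | middle i     = inj₂ (inj₂ (shift (χ j) gv i))

      nonzero-regular : Regular S p
      nonzero-regular
        with large-split p (lowerSet (χ j)) upperOrMiddle
               (∩-large (large-∁ p (kernelOf (χ j)) small) x∈p) classify
        where
        upperOrMiddle : Subset setoid
        upperOrMiddle = record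
          { member   = λ z → member (lowerSet (negation G (χ j))) z ⊎ member (middleSet (χ j)) z
          ; respects = λ { e (inj₁ l) → inj₁ (respects (lowerSet (negation G (χ j))) e l)
                         ; e (inj₂ m) → inj₂ (respects (middleSet (χ j)) e m) }
          }
      ... | inj₁ L∈p = lowerSet-regular (χ j) L∈p
      ... | inj₂ R∈p
        with large-split p (lowerSet (negation G (χ j))) (middleSet (χ j)) R∈p (λ z → z)
      ... | inj₁ U∈p = lowerSet-regular (negation G (χ j)) U∈p
      ... | inj₂ M∈p = ⊥-elim (middleSet-small (χ j) M∈p)

    module _ (kernels : ∀ j → large p (kernelOf (χ j))) (I∉p : ¬ large p involutions) where
      nonvanishing-square : ∀ {z} → member (∁ involutions ∩ Products S x) z →
        ∃[ j ] ¬ graph (χ j) (z ∙ z , 0ℚ) × (∀ i → i ℕ.< j → graph (χ i) (z ∙ z , 0ℚ))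
      nonvanishing-square {z} (zz≉ε , b , e) =
        let k , k∉ , before = least em (λ j → ¬ graph (χ j) (z ∙ z , 0ℚ)) j₀ j₀-nonzero
        in k , k∉ , λ i i<k → stable i (before i i<k)
        where
        -- The code of z, read as a number, is the index of a character that separates z² from ε.
        j₀ = ℕᵇ.toℕ b

        element-j₀ : element j₀ ≈ z
        element-j₀ = trans (reflexive (≡.cong (product S x) (ℕᵇ.fromℕ-toℕ b))) e

        j₀-nonzero : ¬ graph (χ j₀) (z ∙ z , 0ℚ)
        j₀-nonzero g₀ =
          let ee = ∙-cong element-j₀ element-j₀
              v , gv , v∉ℤ = proj₂ (proj₂ (Separating j₀)) (λ e′ → zz≉ε (trans (sym ee) e′))
          in v∉ℤ (≡.subst IsInteger (ℚ.+-identityʳ v)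
               (unique (χ j₀) (resp (χ j₀) (ee , ≡.refl) gv) g₀))

        stable : ∀ i → ¬ ¬ graph (χ i) (z ∙ z , 0ℚ) → graph (χ i) (z ∙ z , 0ℚ)
        stable i ¬¬g with em {graph (χ i) (z ∙ z , 0ℚ)}
        ... | yes g = g
        ... | no ¬g = ⊥-elim (¬¬g ¬g)

      classify-square : ∀ {z} → member (∁ involutions ∩ Products S x) z →
        member (firstLowerSet χ) z ⊎ member (firstLowerSet (negation G ∘ χ)) z
      classify-square z∈@(_ , z∈x) with nonvanishing-square z∈
      ... | j , zz∉ , before with value j z∈x
      ... | v , gv with residue v
      ... | integer i    = ⊥-elim (zz∉ (closed-∙ (χ j) (kernel-zero j gv i) (kernel-zero j gv i)))
      ... | lower r i r∈ = inj₁ (j , before , r , shift (χ j) gv i , r∈)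
      ... | upper r i r∈ = inj₂ (j , before , ℚ.- r ,
        resp (χ j) (refl , ≡.sym (neg-involutive r)) (shift (χ j) gv i) , r∈)
      ... | middle i     = ⊥-elim (zz∉ (kernel-zero j {v = 1ℚ}
        (closed-∙ (χ j) (shift (χ j) {r = ½} gv i) (shift (χ j) {r = ½} gv i)) integer-1))

      square-regular : Regular S p
      square-regular
        with large-split p (firstLowerSet χ) (firstLowerSet (negation G ∘ χ))
               (∩-large (large-∁ p involutions I∉p) x∈p) classify-square
      ... | inj₁ F∈p = firstLowerSet-regular χ kernels F∈p
      ... | inj₂ F∈p = firstLowerSet-regular (negation G ∘ χ) kernels F∈p

    regular : Regular S p
    regular with em {∃[ j ] ¬ large p (kernelOf (χ j))}
    ... | yes (j , small) = nonzero-regular j small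
    ... | no  none with em {large p involutions}
    ...   | yes I∈p = involutions-regular I∈p ε∉p
    ...   | no  I∉p = square-regular kernels I∉p
      where
      kernels : ∀ j → large p (kernelOf (χ j))
      kernels j with em {large p (kernelOf (χ j))}
      ... | yes K∈p = K∈p
      ... | no  K∉p = ⊥-elim (none (j , K∉p))

-- Commutative semigroups

subsemigroup : (S : Semigroup ℓ ℓ) (A : Subset (Semigroup.setoid S)) →
  (∀ {s t} → member A s → member A t → member A (Semigroup._∙_ S s t)) → Semigroup ℓ ℓ
subsemigroup S A closed = record
  { Carrier     = Σ Carrier (member A)
  ; _≈_         = _≈_ on proj₁
  ; _∙_         = λ (s , s∈A) (t , t∈A) → s ∙ t , closed s∈A t∈A
  ; isSemigroup = record
    { isMagma = record
      { isEquivalence = On.isEquivalence proj₁ isEquivalence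
      ; ∙-cong        = ∙-cong
      }
    ; assoc = λ (s , _) (t , _) (u , _) → assoc s t u
    }
  }
  where open Semigroup S

module _ (S : Semigroup ℓ ℓ) (comm : IsCommutative S) where
  open Semigroup S

  bundle : CommutativeSemigroup ℓ ℓ
  bundle = record { isCommutativeSemigroup = record { isSemigroup = isSemigroup ; comm = comm } }

  open CommutativeSemigroupProperties bundle using (interchange; x∙yz≈y∙xz; xy∙z≈y∙xz)

  -- A pair (a , b) stands for a ∙ b⁻¹ in the group of fractions.
  module _ (o : Carrier) where
    infix 4 _≈ᶠ_
    _≈ᶠ_ : Carrier × Carrier → Carrier × Carrier → Set ℓ
    (a , b) ≈ᶠ (c , d) = ∃[ s ] (a ∙ d) ∙ s ≈ (c ∙ b) ∙ s

    ≈⇒≈ᶠ : ∀ {a b c d} → a ∙ d ≈ c ∙ b → (a , b) ≈ᶠ (c , d)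
    ≈⇒≈ᶠ e = o , ∙-congʳ e

    ≈ᶠ-trans : ∀ {f g h} → f ≈ᶠ g → g ≈ᶠ h → f ≈ᶠ h
    -- The first equation is multiplied by b″ t and the second by b s; the leftover common factor is
    -- b′ s t.
    ≈ᶠ-trans {a , b} {a′ , b′} {a″ , b″} (s , e) (t , e′) = b′ ∙ (s ∙ t) , (begin
      (a ∙ b″) ∙ (b′ ∙ (s ∙ t))   ≈⟨ interchange a b″ b′ (s ∙ t) ⟩
      (a ∙ b′) ∙ (b″ ∙ (s ∙ t))   ≈⟨ ∙-congˡ (x∙yz≈y∙xz b″ s t) ⟩
      (a ∙ b′) ∙ (s ∙ (b″ ∙ t))   ≈⟨ assoc _ _ _ ⟨
      ((a ∙ b′) ∙ s) ∙ (b″ ∙ t)   ≈⟨ ∙-congʳ (trans e (assoc a′ b s)) ⟩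
      (a′ ∙ (b ∙ s)) ∙ (b″ ∙ t)   ≈⟨ interchange a′ (b ∙ s) b″ t ⟩
      (a′ ∙ b″) ∙ ((b ∙ s) ∙ t)   ≈⟨ ∙-congˡ (comm (b ∙ s) t) ⟩
      (a′ ∙ b″) ∙ (t ∙ (b ∙ s))   ≈⟨ assoc _ _ _ ⟨
      ((a′ ∙ b″) ∙ t) ∙ (b ∙ s)   ≈⟨ ∙-congʳ (trans e′ (assoc a″ b′ t)) ⟩
      (a″ ∙ (b′ ∙ t)) ∙ (b ∙ s)   ≈⟨ interchange a″ (b′ ∙ t) b s ⟩
      (a″ ∙ b) ∙ ((b′ ∙ t) ∙ s)   ≈⟨ ∙-congˡ (trans (assoc b′ t s) (∙-congˡ (comm t s))) ⟩
      (a″ ∙ b) ∙ (b′ ∙ (s ∙ t))   ∎)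
      where open ≈-Reasoning setoid

    shuffle : ∀ a b c d s t →
      ((a ∙ c) ∙ (b ∙ d)) ∙ (s ∙ t) ≈ ((a ∙ b) ∙ s) ∙ ((c ∙ d) ∙ t)
    shuffle a b c d s t =
      trans (∙-congʳ (interchange a c b d)) (interchange (a ∙ b) (c ∙ d) s t)

    fractions : AbelianGroup ℓ ℓ
    fractions = record
      { Carrier = Carrier × Carrier
      ; _≈_     = _≈ᶠ_
      ; _∙_     = λ (a , b) (c , d) → a ∙ c , b ∙ d
      ; ε       = o , o
      ; _⁻¹     = λ (a , b) → b , a
      ; isAbelianGroup = record
        { isGroup = record
          { isMonoid = record
            { isSemigroup = record
              { isMagma = record
                { isEquivalence = record
                  { refl  = ≈⇒≈ᶠ refl
                  ; sym   = λ (s , e) → s , sym e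
                  ; trans = ≈ᶠ-trans
                  }
                ; ∙-cong = λ { {a , b} {a′ , b′} {c , d} {c′ , d′} (s , e) (t , e′) → s ∙ t ,
                    trans (shuffle a b′ c d′ s t)
                      (trans (∙-cong e e′) (sym (shuffle a′ b c′ d s t))) }
                }
              ; assoc = λ (a , b) (c , d) (f , g) →
                  ≈⇒≈ᶠ (∙-cong (assoc a c f) (sym (assoc b d g)))
              }
            ; identity = (λ (a , b) → ≈⇒≈ᶠ (xy∙z≈y∙xz o a b))
                       , (λ (a , b) → ≈⇒≈ᶠ (trans (assoc a o b) (∙-congˡ (comm o b))))
            }
          ; inverse = (λ (a , b) → ≈⇒≈ᶠ (trans (comm _ o) (∙-congˡ (comm b a))))
                    , (λ (a , b) → ≈⇒≈ᶠ (trans (comm _ o) (∙-congˡ (comm a b))))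
          ; ⁻¹-cong = λ { {a , b} {a′ , b′} (s , e) → s ,
              trans (∙-congʳ (comm b a′)) (trans (sym e) (∙-congʳ (comm a b′))) }
          }
        ; comm = λ (a , b) (c , d) → ≈⇒≈ᶠ (∙-cong (comm a c) (comm d b))
        }
      }

    -- There is no identity to write a as a / 1, hence a ∙ a / a.
    toFraction : Carrier → Carrier × Carrier
    toFraction a = a ∙ a , a

    toFraction-homo : MagmaMorphisms.IsMagmaHomomorphism
      rawMagma (AbelianGroup.rawMagma fractions) toFraction
    toFraction-homo = record
      { isRelHomomorphism = record
        { cong = λ a≈b → ≈⇒≈ᶠ (∙-cong (∙-cong a≈b a≈b) (sym a≈b)) }
      ; homo = λ a b → ≈⇒≈ᶠ (∙-congʳ (interchange a b a b))
      }

    -- Triviality of the fraction means a a o s ≈ o a s for some s, so `a` fixes a o s.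
    toFraction≈ε : ∀ {a} → toFraction a ≈ᶠ (o , o) → ∃[ u ] a ∙ u ≈ u
    toFraction≈ε {a} (s , e) = a ∙ (o ∙ s) ,
      trans (sym (assoc _ _ _)) (trans (sym (assoc _ _ _)) (trans e
        (trans (∙-congʳ (comm o a)) (assoc _ _ _))))

  -- Powers, divisibility and archimedean components

  power : Carrier → ℕ → Carrier
  power a zero    = a
  power a (suc n) = a ∙ power a n

  -- `power a n` has n + 1 factors, there being no identity to start from; hence the extra
  -- successor.
  power-+ : ∀ a m n → power a m ∙ power a n ≈ power a (suc (m ℕ.+ n))
  power-+ a zero    n = refl
  power-+ a (suc m) n = trans (assoc _ _ _) (∙-congˡ (power-+ a m n))

  power-cong : ∀ {a b} n → a ≈ b → power a n ≈ power b n
  power-cong zero    e = e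
  power-cong (suc n) e = ∙-cong e (power-cong n e)

  power-∙ : ∀ a b n → power (a ∙ b) n ≈ power a n ∙ power b n
  power-∙ a b zero    = refl
  power-∙ a b (suc n) = trans (∙-congˡ (power-∙ a b n)) (interchange _ _ _ _)

  power-power : ∀ a m n → ∃[ k ] power (power a m) n ≈ power a k
  power-power a m zero    = m , refl
  power-power a m (suc n) =
    let k , e = power-power a m n in suc (m ℕ.+ k) , trans (∙-congˡ e) (power-+ a m k)

  power-idem : ∀ {a} n → a ∙ a ≈ a → power a n ≈ a
  power-idem zero    _ = refl
  power-idem (suc n) e = trans (∙-congˡ (power-idem n e)) e

  infix 4 _⊒_
  -- The archimedean preorder. Its symmetric part is a semilattice congruence and so contains
  -- `𝓝-Rel`: elements of one component divide powers of each other.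
  _⊒_ : Carrier → Carrier → Set ℓ
  a ⊒ c = ∃[ n ] ∃[ s ] power a n ≈ c ∙ s

  ≈⇒⊒ : ∀ {a c} → a ≈ c → a ⊒ c
  ≈⇒⊒ {a} a≈c = 1 , a , ∙-congʳ a≈c

  ⊒-trans : ∀ {a c d} → a ⊒ c → c ⊒ d → a ⊒ d
  ⊒-trans {a} {c} {d} (n , s , e) (m , t , e′) =
    let k , q = power-power a n m
    in k , t ∙ power s m , trans (sym q) (trans (power-cong m e)
         (trans (power-∙ c s m) (trans (∙-congʳ e′) (assoc _ _ _))))

  ⊒-∙ : ∀ {a b c d} → a ⊒ c → b ⊒ d → a ∙ b ⊒ c ∙ d
  ⊒-∙ {a} {b} {c} {d} (n , s , e) (m , t , e′) =
    suc (n ℕ.+ m) , (s ∙ power a m) ∙ (t ∙ power b n) ,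
    trans (power-∙ a b (suc (n ℕ.+ m))) (trans
      (∙-cong
        (trans (sym (power-+ a n m)) (trans (∙-congʳ e) (assoc _ _ _)))
        (trans (reflexive (≡.cong (power b ∘ suc) (ℕ.+-comm n m)))
          (trans (sym (power-+ b m n)) (trans (∙-congʳ e′) (assoc _ _ _)))))
      (interchange _ _ _ _))

  mutualDivision : Congruence S
  mutualDivision = record
    { _~_           = λ a c → a ⊒ c × c ⊒ a
    ; ≈⇒~           = λ e → ≈⇒⊒ e , ≈⇒⊒ (sym e)
    ; isEquivalence = record
      { refl  = ≈⇒⊒ refl , ≈⇒⊒ refl
      ; sym   = λ (d , d′) → d′ , d
      ; trans = λ (d , d′) (f , f′) → ⊒-trans d f , ⊒-trans f′ d′
      }
    ; ∙-cong        = λ (d , d′) (f , f′) → ⊒-∙ d f , ⊒-∙ d′ f′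
    }

  𝓝⇒⊒ : ∀ {a c} → 𝓝-Rel S a c → a ⊒ c
  𝓝⇒⊒ = proj₁ ∘ 𝓝-smallest S mutualDivision record
    { isBand = record
      { isSemigroup = Semigroup.isSemigroup (S / mutualDivision)
      ; idem        = λ x → (0 , x , refl) , (2 , x , sym (assoc x x x))
      }
    ; comm = λ x y → ≈⇒⊒ (comm x y) , ≈⇒⊒ (comm y x)
    }

  𝓝-refl : ∀ {a} → 𝓝-Rel S a a
  𝓝-refl = 𝓝-≈ refl

  power-𝓝 : ∀ a n → 𝓝-Rel S (power a n) a
  power-𝓝 a zero    = 𝓝-refl
  power-𝓝 a (suc n) = 𝓝-trans (𝓝-cong 𝓝-refl (power-𝓝 a n)) (𝓝-idem a)

  -- An idempotent equals all its powers, so e is a multiple of v; and d fixes every multiple of v.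
  idempotent-absorbs : ∀ {d v e} → d ∙ v ≈ v → 𝓝-Rel S e v → e ∙ e ≈ e → d ∙ e ≈ e
  idempotent-absorbs dv≈v e𝓝v ee≈e =
    let n , s , q = 𝓝⇒⊒ e𝓝v
        e≈vs      = trans (sym (power-idem n ee≈e)) q
    in trans (∙-congˡ e≈vs) (trans (sym (assoc _ _ _)) (trans (∙-congʳ dv≈v) (sym e≈vs)))

  -- An element with a fixed point in its archimedean component is nilpotent
  -- relative to the idempotent of the component.
  power-stabilizes : ∀ {a u} → a ∙ u ≈ u → 𝓝-Rel S a u →
    ∃[ n ] power a n ∙ power a n ≈ power a n
  power-stabilizes {a} {u} au≈u a𝓝u = n , absorb n
    where
    n = proj₁ (𝓝⇒⊒ a𝓝u)
    s = proj₁ (proj₂ (𝓝⇒⊒ a𝓝u))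
    aⁿ≈us : power a n ≈ u ∙ s
    aⁿ≈us = proj₂ (proj₂ (𝓝⇒⊒ a𝓝u))
    fixed : a ∙ power a n ≈ power a n
    fixed = trans (∙-congˡ aⁿ≈us)
      (trans (sym (assoc _ _ _)) (trans (∙-congʳ au≈u) (sym aⁿ≈us)))
    absorb : ∀ k → power a k ∙ power a n ≈ power a n
    absorb zero    = fixed
    absorb (suc k) = trans (assoc _ _ _) (trans (∙-congˡ (absorb k)) fixed)

  component : Carrier → Subset setoid
  component m = record
    { member   = λ y → 𝓝-Rel S y m
    ; respects = λ e y𝓝m → 𝓝-trans (𝓝-≈ (sym e)) y𝓝m
    }

  -- The elements of the component of m that become trivial in its group of
  -- fractions.
  nilpotents : Carrier → Subset setoid
  nilpotents m = record
    { member   = λ a → 𝓝-Rel S a m × ∃[ u ] 𝓝-Rel S u m × a ∙ u ≈ u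
    ; respects = λ e (a𝓝m , u , u𝓝m , q) →
        respects (component m) e a𝓝m , u , u𝓝m , trans (∙-congʳ (sym e)) q
    }

  module _ (p : Ultrafilter setoid) (pr : Productive S p) where
    open Ultrafilter p using (⊆-large; ∩-large)
    private
      em : ExcludedMiddle ℓ
      em = productive⇒em p pr

    module _ (m : Carrier) where
      idempotents : Subset setoid
      idempotents = record
        { member   = λ a → 𝓝-Rel S a m × a ∙ a ≈ a
        ; respects = λ e (a𝓝m , q) →
            respects (component m) e a𝓝m , trans (∙-cong (sym e) (sym e)) (trans q e)
        }

      -- A component has at most one idempotent, because two of them absorb each other.
      idempotents-principal : large p idempotents → Principal S p
      idempotents-principal E∈p =
        let e , e𝓝m , ee≈e = productive⇒inhabited p pr E∈p
        in e , ⊆-large {idempotents} {singleton S e}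
          (λ (f𝓝m , ff≈f) →
            let e𝓝f = 𝓝-trans e𝓝m (𝓝-sym f𝓝m)
            in trans (sym (idempotent-absorbs ff≈f e𝓝f ee≈e))
                 (trans (comm _ _) (idempotent-absorbs ee≈e (𝓝-sym e𝓝f) ff≈f)))
          E∈p

      -- All elements of a set x₀ ∙ Products have a factor x₀, so the longer
      -- products of a sequence inside it reach the idempotent of the component.
      nilpotents-regular : large p (nilpotents m) → ¬ large p idempotents → Regular S p
      nilpotents-regular N∈p E∉p = B , ∩-large N∈p (large-∁ p idempotents E∉p) , reg
        where
        B : Subset setoid
        B = nilpotents m ∩ ∁ idempotents

        module _ {a e : Carrier} (e𝓝m : 𝓝-Rel S e m) (ee≈e : e ∙ e ≈ e) where
          -- Each of the n + 1 factors contributes one a, and the cofactors are nilpotents of the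
          -- component, all of which fix e.
          long-product : ∀ y →
            (∀ n → ∃[ t ] member (nilpotents m) t × a ∙ t ≈ y n) →
            ∀ n → ∃[ b ] ∃[ t ] product S y b ≈ power a n ∙ t × t ∙ e ≈ e
          long-product y factors n with factors 0
          long-product y factors zero | t , (t𝓝m , u , u𝓝m , tu≈u) , q =
            zero , t , sym q , idempotent-absorbs tu≈u (𝓝-trans e𝓝m (𝓝-sym u𝓝m)) ee≈e
          long-product y factors (suc n) | t , (t𝓝m , u , u𝓝m , tu≈u) , q =
            let b , t′ , q′ , t′e≈e = long-product (y ∘ suc) (factors ∘ suc) n
            in 2[1+ b ] , t ∙ t′ , trans (∙-cong (sym q) q′) (interchange _ _ _ _) ,
               trans (assoc _ _ _) (trans (∙-congˡ t′e≈e)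
                 (idempotent-absorbs tu≈u (𝓝-trans e𝓝m (𝓝-sym u𝓝m)) ee≈e))

        reg : ∀ x → (∀ b → member B (product S x b)) →
              ¬ large p (translate S (x 0) (Products S (x ∘ suc)))
        reg x x⊆B tr∈p =
          let (x₀𝓝m , u , u𝓝m , x₀u≈u) , _ = x⊆B zero
              n , ee≈e     = power-stabilizes x₀u≈u (𝓝-trans x₀𝓝m (𝓝-sym u𝓝m))
              e𝓝m          = 𝓝-trans (power-𝓝 (x 0) n) x₀𝓝m
              y , y⊆tr , _ = pr tr∈p
              factors      = λ k →
                let c , q = factor∈Products S y k
                    t , (d , q′) , q″ = y⊆tr c
                in t , respects (nilpotents m) q′ (proj₁ (x⊆B 1+[2 d ])) , trans q″ q
              b , t , q , te≈e  = long-product e𝓝m ee≈e y factors n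
              t′ , (d , q′) , q″ = y⊆tr b
              -- Here e is the idempotent power of x₀, so the long product collapses to e; thus e is
              -- itself a product of x, although B excludes idempotents.
              e≈ = trans (∙-congˡ q′) (trans q″ (trans q (trans (comm _ _) te≈e)))
          in proj₂ (x⊆B 2[1+ d ]) (respects idempotents (sym e≈) (e𝓝m , ee≈e))

-- Reduction to one archimedean component by well-foundedness

module _ (S : Semigroup ℓ ℓ) (comm : IsCommutative S)
         (p : Ultrafilter (Semigroup.setoid S)) (pr : Productive S p) where
  open Semigroup S
  open MagmaMorphisms
  open Ultrafilter p using (⊆-large; ∩-large)

  private
    em : ExcludedMiddle ℓ
    em = productive⇒em p pr

  module _ (m : Carrier) (C∈p : large p (component S comm m)) where
    private
      C : Semigroup ℓ ℓ
      C = subsemigroup S (component S comm m)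
        (λ s𝓝m t𝓝m → 𝓝-trans (𝓝-cong s𝓝m t𝓝m) (𝓝-idem m))

      C-comm : IsCommutative C
      C-comm _ _ = comm _ _

      inclusion : IsMagmaMonomorphism (Semigroup.rawMagma C) rawMagma proj₁
      inclusion = record
        { isMagmaHomomorphism = record
          { isRelHomomorphism = record { cong = λ e → e }
          ; homo              = λ _ _ → refl
          }
        ; injective = λ e → e
        }

      img : Subset (Semigroup.setoid C) → Subset setoid
      img = image C S proj₁ (IsMagmaMonomorphism.isMagmaHomomorphism inclusion)

      C-image∈p : large p (img whole)
      C-image∈p = ⊆-large {component S comm m} {img whole}
        (λ {s} s𝓝m → (s , s𝓝m) , tt , refl) C∈p

      r : Ultrafilter (Semigroup.setoid C)
      r = restriction C S proj₁ inclusion p C-image∈p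

      r-productive : Productive C r
      r-productive {A} = restriction-productive C S proj₁ inclusion p C-image∈p pr {A}

      o : Semigroup.Carrier C
      o = m , 𝓝-≈ refl

      G : AbelianGroup ℓ ℓ
      G = fractions C C-comm o

      f = toFraction C C-comm o
      f-homo = toFraction-homo C C-comm o

    component-dichotomy : Regular S p ⊎ Principal S p
    component-dichotomy
      with abelianGroup-regular G (pushforward C (AbelianGroup.semigroup G) f f-homo r)
             (λ {A} → pushforward-productive C (AbelianGroup.semigroup G) f f-homo r
               (λ {B} → r-productive {B}) {A})
    ... | inj₁ reg = inj₁ (restriction-regular C S proj₁ inclusion p C-image∈p
            (pushforward-regular C (AbelianGroup.semigroup G) f f-homo r reg))
    ... | inj₂ ε∈q with em {large p (idempotents S comm p pr m)}
    ...   | yes E∈p = inj₂ (idempotents-principal S comm p pr m E∈p)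
    ...   | no  E∉p = inj₁ (nilpotents-regular S comm p pr m N∈p E∉p)
      where
      open AbelianGroup G using () renaming (sym to ≈ᶠ-sym)
      trivialized : Subset (Semigroup.setoid C)
      trivialized = preimage C (AbelianGroup.semigroup G) f f-homo
        (singleton (AbelianGroup.semigroup G) (AbelianGroup.ε G))

      N∈p : large p (nilpotents S comm m)
      N∈p = ⊆-large {img trivialized} {nilpotents S comm m}
        (λ ((a , a𝓝m) , ε≈fa , q) → respects (nilpotents S comm m) q
          (let (u , u𝓝m) , au≈u = toFraction≈ε C C-comm o {a , a𝓝m}
                 (≈ᶠ-sym {AbelianGroup.ε G} {f (a , a𝓝m)} ε≈fa)
           in a𝓝m , u , u𝓝m , au≈u))
        ε∈q

  private
    -- The preimage of a principal ideal of the universal semilattice.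
    ↓ : Carrier → Subset setoid
    ↓ e = record
      { member   = λ y → 𝓝-Rel S (y ∙ e) y
      ; respects = λ q r → 𝓝-trans (𝓝-≈ (∙-congʳ (sym q))) (𝓝-trans r (𝓝-≈ q))
      }

    ↓-cong : ∀ {e f} → 𝓝-Rel S e f → ↓ e ⊆ ↓ f
    ↓-cong e𝓝f y∈ = 𝓝-trans (𝓝-cong (𝓝-≈ refl) (𝓝-sym e𝓝f)) y∈

    LargeBelow : Subset (Semigroup.setoid (universalSemilattice S))
    LargeBelow = record
      { member   = λ e → large p (↓ e)
      ; respects = λ {e} {f} e𝓝f → ⊆-large {↓ e} {↓ f} (↓-cong {e} {f} e𝓝f)
      }

    below-head : ∀ (x : ℕ → Carrier) →
      large p (translate S (x 0) (Products S (x ∘ suc))) → large p (↓ (x 0))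
    below-head x = ⊆-large {translate S (x 0) (Products S (x ∘ suc))} {↓ (x 0)}
      λ (t , _ , q) → respects (↓ (x 0)) q
        (𝓝-trans (𝓝-≈ (trans (comm _ _) (sym (assoc _ _ _)))) (𝓝-cong (𝓝-idem (x 0)) (𝓝-≈ refl)))

  -- If `LargeBelow` is empty, no translate is large. Otherwise it has a minimal class m; if the
  -- component of m is small, `B` consists of the elements strictly below m, and a large translate
  -- by such an x₀ would make `↓ (x 0)` large, against minimality.
  commutative-dichotomy : WellFoundedSemilattice (universalSemilattice S) U →
                          Regular S p ⊎ Principal S p
  commutative-dichotomy wf with em {∃ (member LargeBelow)}
  ... | no  none = inj₁ (whole , Ultrafilter.whole-large p ,
      λ x _ tr∈p → none (x 0 , below-head x tr∈p))
  ... | yes some with wf LargeBelow _ some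
  ... | m , ↓m∈p , minimal with em {large p (component S comm m)}
  ... | yes C∈p = component-dichotomy m C∈p
  ... | no  C∉p = inj₁ (↓ m ∩ ∁ (component S comm m) ,
      ∩-large ↓m∈p (large-∁ p (component S comm m) C∉p) ,
      λ x x⊆B tr∈p → let x₀≤m , x₀∉C = x⊆B zero
                     in x₀∉C (minimal (x 0) (below-head x tr∈p) x₀≤m))

-- Solvable inverse semigroups

module _ (S : Semigroup ℓ ℓ) (inv : IsInverseSemigroup S) where
  open Semigroup S

  -- With g the inverse of e f, also h = f g e is an inverse of e f, so g ≈ h is idempotent. An
  -- idempotent is its own inverse, and e f is an inverse of g, whence e f ≈ g.
  idempotent-∙ : ∀ {e f} → Idempotents S e → Idempotents S f → Idempotents S (e ∙ f)
  idempotent-∙ {e} {f} ee≈e ff≈f = trans (∙-cong ef≈g ef≈g) (trans gg≈g (sym ef≈g))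
    where
    open ≈-Reasoning setoid
    g = proj₁ (inv (e ∙ f))
    xgx≈x : ((e ∙ f) ∙ g) ∙ (e ∙ f) ≈ e ∙ f
    xgx≈x = proj₁ (proj₁ (proj₂ (inv (e ∙ f))))
    gxg≈g : (g ∙ (e ∙ f)) ∙ g ≈ g
    gxg≈g = proj₂ (proj₁ (proj₂ (inv (e ∙ f))))
    h = f ∙ (g ∙ e)

    h-absorbs : ∀ s → h ∙ ((e ∙ f) ∙ s) ≈ f ∙ ((g ∙ (e ∙ f)) ∙ s)
    h-absorbs s = begin
      h ∙ ((e ∙ f) ∙ s)             ≈⟨ trans (∙-congˡ (assoc e f s)) (assoc f (g ∙ e) _) ⟩
      f ∙ ((g ∙ e) ∙ (e ∙ (f ∙ s))) ≈⟨ ∙-congˡ (trans (assoc g e _) (∙-congˡ (sym (assoc e e _)))) ⟩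
      f ∙ (g ∙ ((e ∙ e) ∙ (f ∙ s))) ≈⟨ ∙-congˡ (∙-congˡ (trans (∙-congʳ ee≈e) (sym (assoc e f s)))) ⟩
      f ∙ (g ∙ ((e ∙ f) ∙ s))       ≈⟨ ∙-congˡ (assoc g (e ∙ f) s) ⟨
      f ∙ ((g ∙ (e ∙ f)) ∙ s)       ∎

    xh≈xge : (e ∙ f) ∙ h ≈ (e ∙ f) ∙ (g ∙ e)
    xh≈xge = begin
      (e ∙ f) ∙ (f ∙ (g ∙ e)) ≈⟨ trans (assoc e f _) (∙-congˡ (sym (assoc f f _))) ⟩
      e ∙ ((f ∙ f) ∙ (g ∙ e)) ≈⟨ ∙-congˡ (∙-congʳ ff≈f) ⟩
      e ∙ (f ∙ (g ∙ e))       ≈⟨ assoc e f _ ⟨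
      (e ∙ f) ∙ (g ∙ e)       ∎

    xhx≈x : ((e ∙ f) ∙ h) ∙ (e ∙ f) ≈ e ∙ f
    xhx≈x = begin
      ((e ∙ f) ∙ h) ∙ (e ∙ f)       ≈⟨ ∙-congʳ xh≈xge ⟩
      ((e ∙ f) ∙ (g ∙ e)) ∙ (e ∙ f) ≈⟨ ∙-congʳ (sym (assoc (e ∙ f) g e)) ⟩
      (((e ∙ f) ∙ g) ∙ e) ∙ (e ∙ f) ≈⟨ trans (assoc _ e _) (∙-congˡ (sym (assoc e e f))) ⟩
      ((e ∙ f) ∙ g) ∙ ((e ∙ e) ∙ f) ≈⟨ ∙-congˡ (∙-congʳ ee≈e) ⟩
      ((e ∙ f) ∙ g) ∙ (e ∙ f)       ≈⟨ xgx≈x ⟩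
      e ∙ f                         ∎

    hxs : ∀ s → f ∙ ((g ∙ (e ∙ f)) ∙ (g ∙ s)) ≈ f ∙ (g ∙ s)
    hxs s = ∙-congˡ (trans (sym (assoc _ g s)) (∙-congʳ gxg≈g))

    hxh≈h : (h ∙ (e ∙ f)) ∙ h ≈ h
    hxh≈h = begin
      (h ∙ (e ∙ f)) ∙ h           ≈⟨ assoc h (e ∙ f) h ⟩
      h ∙ ((e ∙ f) ∙ h)           ≈⟨ ∙-congˡ xh≈xge ⟩
      h ∙ ((e ∙ f) ∙ (g ∙ e))     ≈⟨ h-absorbs (g ∙ e) ⟩
      f ∙ ((g ∙ (e ∙ f)) ∙ (g ∙ e)) ≈⟨ hxs e ⟩
      h                           ∎

    g≈h : g ≈ h
    g≈h = proj₂ (proj₂ (inv (e ∙ f))) (xhx≈x , hxh≈h)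

    hh≈h : h ∙ h ≈ h
    hh≈h = begin
      (f ∙ (g ∙ e)) ∙ (f ∙ (g ∙ e))   ≈⟨ assoc f (g ∙ e) _ ⟩
      f ∙ ((g ∙ e) ∙ (f ∙ (g ∙ e)))   ≈⟨ ∙-congˡ (trans (assoc g e _) (∙-congˡ (sym (assoc e f _)))) ⟩
      f ∙ (g ∙ ((e ∙ f) ∙ (g ∙ e)))   ≈⟨ ∙-congˡ (sym (assoc g (e ∙ f) _)) ⟩
      f ∙ ((g ∙ (e ∙ f)) ∙ (g ∙ e))   ≈⟨ hxs e ⟩
      h                               ∎

    gg≈g : g ∙ g ≈ g
    gg≈g = trans (∙-cong g≈h g≈h) (trans hh≈h (sym g≈h))

    ef≈g : e ∙ f ≈ g
    ef≈g = let _ , _ , unique = inv g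
           in trans (sym (unique (gxg≈g , xgx≈x)))
                (unique (trans (∙-congʳ gg≈g) gg≈g , trans (∙-congʳ gg≈g) gg≈g))

  range : Carrier → Carrier
  range a = a ∙ proj₁ (inv a)

  range-idempotent : ∀ a → Idempotents S (range a)
  range-idempotent a = trans (sym (assoc _ _ _)) (∙-congʳ (proj₁ (proj₁ (proj₂ (inv a)))))

  module _ (γ : Congruence S) where
    private
      Q = S / γ
      open Congruence γ using (≈⇒~)

    ≈⇒𝓝 : ∀ {a b} → a ≈ b → 𝓝-Rel Q a b
    ≈⇒𝓝 e = 𝓝-≈ (≈⇒~ e)

    -- Modulo 𝓝, a ≈ (a a⁻¹) a becomes a a a⁻¹ and then a a⁻¹. So each class contains an idempotent
    -- of `S`, which connects the universal semilattice with E(S).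
    𝓝-range : ∀ a → 𝓝-Rel Q a (range a)
    𝓝-range a = 𝓝-trans (≈⇒𝓝 (sym (proj₁ (proj₁ (proj₂ (inv a))))))
      (𝓝-trans (𝓝-comm (range a) a)
      (𝓝-trans (≈⇒𝓝 (sym (assoc _ _ _))) (𝓝-cong (𝓝-idem a) (≈⇒𝓝 refl))))

    universalSemilattice-wellFounded : WellFoundedSemilattice S (Idempotents S) →
      WellFoundedSemilattice (universalSemilattice Q) U
    universalSemilattice-wellFounded wf A _ (a , a∈A) =
      let m , (m∈A , mm≈m) , minimal = wf idempotentsOfA proj₂
            (range a , respects A (𝓝-range a) a∈A , range-idempotent a)
      in m , m∈A , λ y y∈A ym𝓝y →
        -- y ≤ m is known only for classes. The idempotent `range y ∙ m` represents the class of y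
        -- and lies below m in E(S) itself.
        let em𝓝y = 𝓝-trans (𝓝-cong (𝓝-sym (𝓝-range y)) (≈⇒𝓝 refl)) ym𝓝y
            em≈m = minimal (range y ∙ m)
              (respects A (𝓝-sym em𝓝y) y∈A , idempotent-∙ (range-idempotent y) mm≈m)
              (trans (assoc _ _ _) (∙-congˡ mm≈m))
        in 𝓝-trans (𝓝-sym em𝓝y) (≈⇒𝓝 em≈m)
      where
      idempotentsOfA : Subset setoid
      idempotentsOfA = record
        { member   = λ e → member A e × Idempotents S e
        ; respects = λ q (e∈A , ee≈e) → respects A (≈⇒𝓝 q) e∈A ,
            trans (∙-cong (sym q) (sym q)) (trans ee≈e q)
        }

-- Lets the result on universal semilattices of quotients apply to `S` itself in the commutative
-- case.
equality : (S : Semigroup ℓ ℓ) → Congruence S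
equality S = record
  { _~_ = _≈_ ; ≈⇒~ = id ; isEquivalence = isEquivalence ; ∙-cong = ∙-cong }
  where open Semigroup S

module _ (S : Semigroup ℓ ℓ) (γ : Congruence S) (comm : IsCommutative (S / γ)) where
  open Semigroup S
  open MagmaMorphisms

  quotientMap : IsMagmaHomomorphism rawMagma (Semigroup.rawMagma (S / γ)) id
  quotientMap = record
    { isRelHomomorphism = record { cong = Congruence.≈⇒~ γ }
    ; homo              = λ _ _ → Congruence.≈⇒~ γ refl
    }

  kernel-inclusion : IsMagmaMonomorphism (Semigroup.rawMagma (kernel S γ comm)) rawMagma proj₁
  kernel-inclusion = record
    { isMagmaHomomorphism = record
      { isRelHomomorphism = record { cong = id }
      ; homo              = λ _ _ → refl
      }
    ; injective = id
    }

  kernel-wellFounded : WellFoundedSemilattice S (Idempotents S) →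
    WellFoundedSemilattice (kernel S γ comm) (Idempotents (kernel S γ comm))
  kernel-wellFounded wf A A⊆E ((a , a∈K) , a∈A) =
    let m , ((m∈K , m∈A) , _) , minimal = wf imageOfA proj₂ (a , (a∈K , a∈A) , A⊆E a∈A)
    in (m , m∈K) , m∈A , λ (y , y∈K) y∈A y≤m → minimal y ((y∈K , y∈A) , A⊆E y∈A) y≤m
    where
    imageOfA : Subset setoid
    imageOfA = record
      { member   = λ s → Σ (Idempotents (S / γ) s) (λ k → member A (s , k)) × Idempotents S s
      ; respects = λ {s} {t} q ((s∈K , s∈A) , ss≈s) →
          let tt≈t = trans (∙-cong (sym q) (sym q)) (trans ss≈s q)
              -- Idempotents of `S` always lie in the kernel, which supplies the membership proof
              -- for t.
              t∈K  = Congruence.≈⇒~ γ tt≈t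
          in (t∈K , respects A q s∈A) , tt≈t
      }

  module _ (p : Ultrafilter setoid) (pr : Productive S p) where
    quotient : Ultrafilter (Semigroup.setoid (S / γ))
    quotient = pushforward S (S / γ) id quotientMap p

    quotient-productive : Productive (S / γ) quotient
    quotient-productive {A} = pushforward-productive S (S / γ) id quotientMap p pr {A}

    -- A principal productive ultrafilter is concentrated at an idempotent e, and elements congruent
    -- to e are then idempotent modulo γ.
    kernel-large : Principal (S / γ) quotient → large p (image (kernel S γ comm) S proj₁
                     (IsMagmaMonomorphism.isMagmaHomomorphism kernel-inclusion) whole)
    kernel-large (e , e∈q) = Ultrafilter.⊆-large p
      {preimage S (S / γ) id quotientMap (singleton (S / γ) e)}
      {image (kernel S γ comm) S proj₁
        (IsMagmaMonomorphism.isMagmaHomomorphism kernel-inclusion) whole}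
      (λ {s} e~s → (s , Q.trans (Q.∙-cong (Q.sym e~s) (Q.sym e~s)) (Q.trans ee~e e~s)) , tt , refl)
      e∈q
      where
      module Q = Semigroup (S / γ)
      ee~e : Idempotents (S / γ) e
      ee~e = principal⇒idempotent quotient (λ {A} → quotient-productive {A}) e∈q

-- If the image of p in S/γ is principal, then p lives on the kernel.
solvable-dichotomy : ∀ {n} (S : Semigroup ℓ ℓ) → SolvableOfClass n S →
  WellFoundedSemilattice S (Idempotents S) →
  (p : Ultrafilter (Semigroup.setoid S)) → Productive S p → Regular S p ⊎ Principal S p
solvable-dichotomy S (commutative inv comm) wf p pr = commutative-dichotomy S comm p pr
  (universalSemilattice-wellFounded S inv (equality S) wf)
solvable-dichotomy S (extension inv γ comm solvable) wf p pr
  with commutative-dichotomy (S / γ) comm (quotient S γ comm p pr)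
         (λ {A} → quotient-productive S γ comm p pr {A})
         (universalSemilattice-wellFounded S inv γ wf)
... | inj₁ reg = inj₁ (pushforward-regular S (S / γ) id (quotientMap S γ comm) p reg)
... | inj₂ principal = Sum.map
    (restriction-regular K S proj₁ incl p K∈p) (restriction-principal K S proj₁ incl p K∈p)
    (solvable-dichotomy K solvable (kernel-wellFounded S γ comm wf)
      (restriction K S proj₁ incl p K∈p)
      (λ {A} → restriction-productive K S proj₁ incl p K∈p pr {A}))
  where
  K    = kernel S γ comm
  incl = kernel-inclusion S γ comm
  K∈p  = kernel-large S γ comm p pr principal

mainTheorem1 : {ℓ : Level} (S : Semigroup ℓ ℓ) →
    (IsCommutative S × WellFoundedSemilattice (universalSemilattice S) U)
    ⊎ (SolvableInverse S × WellFoundedSemilattice S (Idempotents S)) →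
    (p : Ultrafilter (Semigroup.setoid S)) →
    StronglyProductive S p → IdempotentUltrafilter S p
mainTheorem1 S hypothesis p sp = conclude (productive⇒em p pr) (dichotomy hypothesis)
  where
  pr : Productive S p
  pr {A} = stronglyProductive⇒productive S p sp {A}

  dichotomy : (IsCommutative S × WellFoundedSemilattice (universalSemilattice S) U)
    ⊎ (SolvableInverse S × WellFoundedSemilattice S (Idempotents S)) → Regular S p ⊎ Principal S p
  dichotomy (inj₁ (comm , wf))           = commutative-dichotomy S comm p pr wf
  dichotomy (inj₂ ((n , solvable) , wf)) = solvable-dichotomy S solvable wf p pr

  conclude : Dec (Principal S p) → Regular S p ⊎ Principal S p → IdempotentUltrafilter S p
  conclude _         (inj₂ principal) = principal⇒idempotentUltrafilter p pr principal
  conclude (yes pri) (inj₁ _)         = principal⇒idempotentUltrafilter p pr pri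
  conclude (no ¬pri) (inj₁ reg)       = regular⇒idempotentUltrafilter p pr ¬pri reg
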